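{- If $u>1$ and $v>1$ are odd integers, then there exists an optimal $(4u\times 8v,\{4,5\},1)$-BDP, i.e. an optimal balanced $(Z_{4u}\times Z_{8v},\{4,5\},1)$ difference packing.
   Context: Let $G$ be a finite additive group and $K$ a set of positive integers. For $C\subseteq G$, $\Delta C$ denotes the multiset of all differences $x-y$ with $(x,y)$ an ordered pair of distinct elements of $C$. A $(G,K,1)$ difference packing is a set $\mathcal B$ of subsets of $G$ (blocks), each of size in $K$, such that the multiset $\bigcup_{B\in\mathcal B}\Delta B$ contains every element of $G$ at most once. It is balanced (a $(G,K,1)$-BDP) if the number of blocks of size $k$ is the same for every $k\in K$. Let $I(G)$ be the set consisting of the identity and all involutions of $G$. A $(G,K,1)$-BDP is optimal if for every $k\in K$ its number of blocks of size $k$ equals $\left\lfloor |G\setminus I(G)| / \sum_{k'\in K}(k'^2-k')\right\rfloor$. A $(u\times v,K,1)$-BDP means a $(Z_u\times Z_v,K,1)$-BDP. -}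

module Defs where

open import Data.Nat using (ℕ; zero; suc; _+_; _*_; _∸_; _<_; _%_; _/_)
open import Data.Nat.Properties using (_≟_)
open import Data.Product using (_×_; _,_)
open import Data.Product.Properties using (≡-dec)
open import Data.List using (List; []; _∷_; map; concatMap; filter; length; upTo; cartesianProduct)
open import Data.Nat.ListAction using (sum)
open import Data.List.Relation.Unary.All using (All)
open import Data.List.Relation.Unary.Unique.Propositional using (Unique)
open import Data.List.Membership.Propositional using (_∈_)
open import Relation.Nullary using (¬?)
open import Relation.Binary.PropositionalEquality using (_≡_)
open import Relation.Binary.Definitions using (DecidableEquality)

-- Elements of Z_m × Z_n are represented by pairs (a , b) of naturals
-- with a < m and b < n (canonical residues).
Elt : Set
Elt = ℕ × ℕ

_≟ₑ_ : DecidableEquality Elt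
_≟ₑ_ = ≡-dec _≟_ _≟_

-- reduction modulo m (only used for m > 0)
modℕ : ℕ → ℕ → ℕ
modℕ zero    x = x
modℕ (suc k) x = x % suc k

-- floor division (only used for nonzero divisor)
divℕ : ℕ → ℕ → ℕ
divℕ x zero    = 0
divℕ x (suc k) = x / suc k

InG : ℕ → ℕ → Elt → Set
InG m n (a , b) = (a < m) × (b < n)

addG : ℕ → ℕ → Elt → Elt → Elt
addG m n (a , b) (c , d) = modℕ m (a + c) , modℕ n (b + d)

subG : ℕ → ℕ → Elt → Elt → Elt
subG m n (a , b) (c , d) = modℕ m (a + (m ∸ c)) , modℕ n (b + (n ∸ d))

elemsG : ℕ → ℕ → List Elt
elemsG m n = cartesianProduct (upTo m) (upTo n)

-- |G \ I(G)| : number of elements g with g + g ≠ 0, i.e. neither the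
-- identity nor an involution
nonInvCount : ℕ → ℕ → ℕ
nonInvCount m n = length (filter (λ g → ¬? (addG m n g g ≟ₑ (0 , 0))) (elemsG m n))

Δ : ℕ → ℕ → List Elt → List Elt
Δ m n B = concatMap (λ x → map (λ y → subG m n x y) (filter (λ y → ¬? (x ≟ₑ y)) B)) B

numBlocks : ℕ → List (List Elt) → ℕ
numBlocks k ℬ = length (filter (λ B → length B ≟ k) ℬ)

record DifferencePacking (m n : ℕ) (K : List ℕ) (ℬ : List (List Elt)) : Set where
  field
    blocksInG   : All (All (InG m n)) ℬ
    blocksSets  : All Unique ℬ
    blockSizes  : All (λ B → length B ∈ K) ℬ
    packing     : Unique (concatMap (Δ m n) ℬ)

Balanced : List ℕ → List (List Elt) → Set
Balanced K ℬ = ∀ {k k'} → k ∈ K → k' ∈ K → numBlocks k ℬ ≡ numBlocks k' ℬ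

record BDP (m n : ℕ) (K : List ℕ) (ℬ : List (List Elt)) : Set where
  field
    isPacking  : DifferencePacking m n K ℬ
    isBalanced : Balanced K ℬ

Optimal : ℕ → ℕ → List ℕ → List (List Elt) → Set
Optimal m n K ℬ = ∀ {k} → k ∈ K →
  numBlocks k ℬ ≡ divℕ (nonInvCount m n) (sum (map (λ k' → k' * k' ∸ k') K))

OptimalBDP : ℕ → ℕ → List ℕ → List (List Elt) → Set
OptimalBDP m n K ℬ = BDP m n K ℬ × Optimal m n K ℬ

{-# OPTIONS --safe #-}

-- A family over (Z_m × Z_n) × (Z_u × Z_v) is a system of pairs (5-block,
-- 4-block) whose differences, 32 for each pair, exhaust the complement of the
-- factor Z_m × Z_n.  Write u = 3^a w and v = 3^b w′ with w, w′ prime to 6.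
--
-- For w prime to 6 put the s-th point of a block over (g_s , s y), where y runs
-- over a half-system modulo w.  A difference then lies over μ y with μ = ±1, …,
-- ±4, and two differences of slopes μ, 2 μ collide only if the one position is
-- twice the other.  The g_s depend on which of 24 arcs of the circle Z_w contains
-- y; since doubling maps each arc onto two arcs, collisions are excluded by a
-- finite check.
--
-- Families multiply: inflating one by a difference matrix with five rows and
-- filling the kernel with another gives a family over the product.  Scalar
-- multiples give the matrices prime to 6; F₉ and a matrix over Z_27 give the
-- others, so that the 3-part is built from lists for Z_9, Z_27, Z_81,
-- Z_3 × Z_3 and Z_9 × Z_3.  This leaves out Z_3 alone: if a + b = 1, the factor
-- Z_3 is absorbed in the base group, which becomes Z_12 × Z_8 or Z_4 × Z_24 and
-- itself receives two more pairs.
--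
-- In the end 32 (c + 1) = |G| for c pairs.  A difference is never an involution,
-- as d = −d would make d occur twice, so that |G ∖ I(G)| lies between 32 c and
-- 32 (c + 1) − 1, which is optimality.
module Submission where

open import Defs
open import Data.Nat using (ℕ; zero; suc; NonZero; _*_; _%_; _/_; _≡ᵇ_; _<_; _<ᵇ_; _≤_; z≤n; s≤s; z<s; _^_)
import Data.Nat as ℕ
import Data.Nat.Properties as ℕ
open import Data.Integer using (ℤ; +_; 0ℤ; -[1+_]; _%ℕ_; _/ℕ_)
import Data.Integer as ℤ
import Data.Integer.Properties as ℤ
open import Data.Integer.Tactic.RingSolver using (solve-∀)
import Data.Nat.Tactic.RingSolver as ℕSolver
open import Data.Bool using (Bool; true; false; T; _∧_; not; T?)
open import Data.Fin using (Fin; zero; suc; toℕ; fromℕ<)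
open import Data.Fin.Patterns
open import Data.List using (List; []; _∷_; map; _++_; cartesianProduct; length; concatMap; lookup; filter; allFin; upTo)
open import Data.List.Properties using (length-++; length-map; length-tabulate; filter-accept; filter-reject; length-upTo; concatMap-++; filter-++; filter-all; filter-none; filter-notAll)
open import Data.List.Relation.Unary.Unique.Propositional using (Unique)
import Data.List.Relation.Unary.Unique.Propositional.Properties as Unique
open import Data.List.Membership.Propositional.Properties using (∈-map⁻; ∈-map⁺; ∈-++⁺ˡ; ∈-++⁺ʳ; ∈-filter⁺; ∈-filter⁻; ∈-cartesianProduct⁺; ∈-allFin; ∈-lookup; ∈-upTo⁺; ∈-++⁻; ∈-∃++; ∈-concatMap⁻; ∈-cartesianProduct⁻)
open import Data.Product using (Σ; ∃; _×_; _,_; proj₁; proj₂)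
open import Data.Product.Properties using (≡-dec)
open import Data.Empty using (⊥; ⊥-elim)
open import Relation.Nullary using (¬_; Dec; yes; no; ¬?)
open import Relation.Binary.PropositionalEquality using (_≡_; _≢_; refl; sym; trans; cong; cong₂; subst; subst₂; module ≡-Reasoning)
import Data.Nat.DivMod as ℕ
open import Data.Bool.Properties using (T-∧)
open import Data.Fin.Properties using (toℕ-injective; toℕ<n; toℕ-fromℕ<; all?)
open import Data.Unit using (tt)
open import Data.Bool.ListAction using (all)
open import Data.List.Relation.Unary.All as All using (All; []; _∷_)
open import Data.List.Relation.Unary.Any using (here; there; Any)
open import Data.List.Relation.Unary.AllPairs as AllPairs using ([]; _∷_)
open import Data.List.Membership.Propositional using (_∈_)
open import Function using (Equivalence)
open import Data.Nat.Divisibility using (_∣_; divides; ∣-trans; ∣n⇒∣m*n; m∣m*n; n∣m*n; ∣⇒≤; m%n≡0⇒n∣m; _∣?_; n∣m⇒m%n≡0)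
open import Data.Nat.Coprimality using (Coprime; coprime-divisor)
open import Relation.Binary.Definitions using (tri<; tri≈; tri>)
import Data.Bool as Bool
open import Data.Sum as Sum using (_⊎_; inj₁; inj₂)
open import Relation.Nullary.Decidable using (toWitness; _→-dec_; _⊎-dec_)
import Data.Nat.Coprimality as Coprimality
import Data.Integer.DivMod as ℤ
import Data.Integer.Divisibility.Signed as Signed
import Data.List.Relation.Unary.All.Properties as All
import Data.List.Relation.Unary.Any as Any
open import Data.List.Relation.Unary.Any.Properties using (lookup-result)
open import Data.Nat.Induction using (<-rec)
import Data.Fin.Properties as Fin

-- Congruences

-- The quotient is part of the data, so that most rules below come down to an identity for the ring
-- solver.
record Cg (n : ℕ) (a b : ℤ) : Set where
  constructor _,_
  field
    quotient : ℤ
    equation : a ≡ b ℤ.+ quotient ℤ.* + n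

cg-refl : ∀ {n a} → Cg n a a
cg-refl {n} {a} = 0ℤ , sym (ℤ.+-identityʳ a)

cg-sym : ∀ {n a b} → Cg n a b → Cg n b a
cg-sym {n} {a} {b} (k , e) = ℤ.- k , trans (lem b k (+ n)) (cong (ℤ._+ (ℤ.- k) ℤ.* + n) (sym e))
  where
  lem : ∀ b k n → b ≡ (b ℤ.+ k ℤ.* n) ℤ.+ (ℤ.- k) ℤ.* n
  lem = solve-∀

cg-trans : ∀ {n a b c} → Cg n a b → Cg n b c → Cg n a c
cg-trans {n} {a} {b} {c} (k , e) (l , f) = l ℤ.+ k , trans e (trans (cong (ℤ._+ k ℤ.* + n) f) (lem c l k (+ n)))
  where
  lem : ∀ c l k n → c ℤ.+ l ℤ.* n ℤ.+ k ℤ.* n ≡ c ℤ.+ (l ℤ.+ k) ℤ.* n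
  lem = solve-∀

cg-reflexive : ∀ {n a b} → a ≡ b → Cg n a b
cg-reflexive refl = cg-refl

-- Modulo `u` the multiples of `u` vanish: this is the projection of Z_{u p} onto Z_u.
cg-coarsen : ∀ u p a b α β → Cg (u * p) (a ℤ.+ + u ℤ.* α) (b ℤ.+ + u ℤ.* β) → Cg u a b
cg-coarsen u p a b α β (k , e) = β ℤ.- α ℤ.+ k ℤ.* + p , (begin
  a                                                    ≡⟨ lem₁ a (+ u) α ⟩
  (a ℤ.+ + u ℤ.* α) ℤ.- + u ℤ.* α                      ≡⟨ cong (ℤ._- + u ℤ.* α) e ⟩
  (b ℤ.+ + u ℤ.* β ℤ.+ k ℤ.* + (u * p)) ℤ.- + u ℤ.* α  ≡⟨ cong (λ z → (b ℤ.+ + u ℤ.* β ℤ.+ k ℤ.* z) ℤ.- + u ℤ.* α) (ℤ.pos-* u p) ⟩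
  (b ℤ.+ + u ℤ.* β ℤ.+ k ℤ.* (+ u ℤ.* + p)) ℤ.- + u ℤ.* α  ≡⟨ lem₂ b (+ u) (+ p) α β k ⟩
  b ℤ.+ (β ℤ.- α ℤ.+ k ℤ.* + p) ℤ.* + u                ∎)
  where
  open ≡-Reasoning
  lem₁ : ∀ a u α → a ≡ (a ℤ.+ u ℤ.* α) ℤ.- u ℤ.* α
  lem₁ = solve-∀
  lem₂ : ∀ b u p α β k → (b ℤ.+ u ℤ.* β ℤ.+ k ℤ.* (u ℤ.* p)) ℤ.- u ℤ.* α ≡ b ℤ.+ (β ℤ.- α ℤ.+ k ℤ.* p) ℤ.* u
  lem₂ = solve-∀

-- The kernel of that projection consists of the multiples of `u` and is a copy of Z_p. The factor
-- `u` is cancelled over the integers.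
cg-cancel : ∀ u p .{{_ : NonZero u}} a α β → Cg (u * p) (a ℤ.+ + u ℤ.* α) (a ℤ.+ + u ℤ.* β) → Cg p α β
cg-cancel u@(suc _) p a α β (k , e) = k , ℤ.*-cancelˡ-≡ (+ u) α _ (begin
  + u ℤ.* α                                            ≡⟨ lem₁ a (+ u) α ⟩
  (a ℤ.+ + u ℤ.* α) ℤ.- a                              ≡⟨ cong (ℤ._- a) e ⟩
  (a ℤ.+ + u ℤ.* β ℤ.+ k ℤ.* + (u * p)) ℤ.- a          ≡⟨ cong (λ z → (a ℤ.+ + u ℤ.* β ℤ.+ k ℤ.* z) ℤ.- a) (ℤ.pos-* u p) ⟩
  (a ℤ.+ + u ℤ.* β ℤ.+ k ℤ.* (+ u ℤ.* + p)) ℤ.- a      ≡⟨ lem₂ a (+ u) (+ p) β k ⟩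
  + u ℤ.* (β ℤ.+ k ℤ.* + p)                            ∎)
  where
  open ≡-Reasoning
  lem₁ : ∀ a u α → u ℤ.* α ≡ (a ℤ.+ u ℤ.* α) ℤ.- a
  lem₁ = solve-∀
  lem₂ : ∀ a u p β k → (a ℤ.+ u ℤ.* β ℤ.+ k ℤ.* (u ℤ.* p)) ℤ.- a ≡ u ℤ.* (β ℤ.+ k ℤ.* p)
  lem₂ = solve-∀

length-cartesianProduct : ∀ {A B : Set} (xs : List A) (ys : List B) →
  length (cartesianProduct xs ys) ≡ length xs * length ys
length-cartesianProduct []       ys = refl
length-cartesianProduct (x ∷ xs) ys = trans (length-++ (map (x ,_) ys))
  (cong₂ ℕ._+_ (length-map (x ,_) ys) (length-cartesianProduct xs ys))

-- Families of pairs of blocks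

data Kind : Set where
  five four : Kind

_==_ : Fin 5 → Fin 5 → Bool
s == t = toℕ s ℕ.≡ᵇ toℕ t

-- Blocks of both kinds are functions on `Fin 5`, so that they share the rows of one difference
-- matrix; for a block of size four the last value is ignored. The valid slots number 20 + 12 = 32.
row : Kind → Fin 5 → Bool
row five _ = true
row four s = toℕ s ℕ.<ᵇ 4

valid : Kind → Fin 5 → Fin 5 → Bool
valid κ s t = row κ s ∧ row κ t ∧ not (s == t)

Slot : Set
Slot = Kind × Fin 5 × Fin 5

Valid : Slot → Set
Valid (κ , s , t) = T (valid κ s t)

valid⇒≢ : ∀ κ {s t} → T (valid κ s t) → s ≢ t
valid⇒≢ five {0F} p refl = p
valid⇒≢ five {1F} p refl = p
valid⇒≢ five {2F} p refl = p
valid⇒≢ five {3F} p refl = p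
valid⇒≢ five {4F} p refl = p
valid⇒≢ four {0F} p refl = p
valid⇒≢ four {1F} p refl = p
valid⇒≢ four {2F} p refl = p
valid⇒≢ four {3F} p refl = p

Pt : Set
Pt = ℤ × ℤ

infixl 6 _⊖_

_⊖_ : Pt → Pt → Pt
(a , b) ⊖ (c , d) = a ℤ.- c , b ℤ.- d

Same : ℕ → ℕ → Pt → Pt → Set
Same m n (a , b) (c , d) = Cg m a c × Cg n b d

Block : Set
Block = Kind → Fin 5 → Pt

diff : Block → Slot → Pt
diff B (κ , s , t) = B κ s ⊖ B κ t

-- Each index carries one block of size five and one of size four.  The
-- differences are distinct in (Z_m × Z_n) × (Z_u × Z_v) and lie off the
-- first factor; there are q (u v − 1) indices.
record Fam (m n q u v : ℕ) : Set₁ where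
  field
    Ix     : Set
    ixs    : List Ix
    unique : Unique ixs
    size   : q ℕ.+ length ixs ≡ q * (u * v)
    g h    : Ix → Block
    inj    : ∀ i j a b → Valid a → Valid b →
             Same m n (diff (g i) a) (diff (g j) b) →
             Same u v (diff (h i) a) (diff (h j) b) → (i , a) ≡ (j , b)
    off    : ∀ i a → Valid a → ¬ Same u v (diff (h i) a) (0ℤ , 0ℤ)

-- A difference matrix over Z_p × Z_r with five rows, stored by columns. As there are p r columns,
-- injectivity means that the difference of two rows takes each value exactly once.
record DiffMatrix (p r : ℕ) : Set₁ where
  field
    Ix     : Set
    ixs    : List Ix
    unique : Unique ixs
    size   : length ixs ≡ p * r
    entry  : Ix → Fin 5 → Pt
    inj    : ∀ d e s t → s ≢ t →
             Same p r (entry d s ⊖ entry d t) (entry e s ⊖ entry e t) → d ≡ e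

swap : ∀ {m n q u v} → Fam m n q u v → Fam m n q v u
swap {q = q} {u} {v} F = record
  { Ix = Ix ; ixs = ixs ; unique = unique
  ; size = trans size (cong (q *_) (ℕ.*-comm u v))
  ; g = g ; h = λ i κ s → proj₂ (h i κ s) , proj₁ (h i κ s)
  ; inj = λ i j a b p q e (x , y) → inj i j a b p q e (y , x)
  ; off = λ i a p (x , y) → off i a p (y , x)
  }
  where open Fam F

-- Inflation of a family by a difference matrix

module Lift {m n q u v p r} .{{_ : NonZero u}} .{{_ : NonZero v}}
            (F : Fam m n q u v) (D : DiffMatrix p r) (F′ : Fam m n q p r) where
  private
    module F  = Fam F
    module D  = DiffMatrix D
    module F′ = Fam F′

  Ix : Set
  Ix = (F.Ix × D.Ix) ⊎ F′.Ix

  ixs : List Ix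
  ixs = map inj₁ (cartesianProduct F.ixs D.ixs) ++ map inj₂ F′.ixs

  infixl 7 _▹_

  O : Pt
  O = 0ℤ , 0ℤ

  -- The subgroup generated by u and v is a copy of Z_p × Z_r inside
  -- Z_{u p} × Z_{v r}, with quotient Z_u × Z_v.
  _▹_ : Pt → Pt → Pt
  (x , y) ▹ (α , β) = x ℤ.+ + u ℤ.* α , y ℤ.+ + v ℤ.* β

  -- Over the quotient Z_u × Z_v the inflated blocks are those of `F`. Row `s` of a block is shifted
  -- inside the kernel by row `s` of the column `d`; the kernel itself is left to `F′`.
  g h : Ix → Block
  g (inj₁ (i , d)) = F.g i
  g (inj₂ i)       = F′.g i
  h (inj₁ (i , d)) κ s = F.h i κ s ▹ D.entry d s
  h (inj₂ i)       κ s = O ▹ F′.h i κ s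

  private
    rearrange : ∀ u x y α β → (x ℤ.- y) ℤ.+ u ℤ.* (α ℤ.- β) ≡ (x ℤ.+ u ℤ.* α) ℤ.- (y ℤ.+ u ℤ.* β)
    rearrange = solve-∀

    coarsen : ∀ P Q P′ Q′ A B A′ B′ → Same (u * p) (v * r) (P ▹ A ⊖ Q ▹ B) (P′ ▹ A′ ⊖ Q′ ▹ B′) →
              Same u v (P ⊖ Q) (P′ ⊖ Q′)
    coarsen (x , y) (z , w) (x′ , y′) (z′ , w′) (a , b) (c , d) (a′ , b′) (c′ , d′) (e₁ , e₂) =
      cg-coarsen u p (x ℤ.- z) (x′ ℤ.- z′) (a ℤ.- c) (a′ ℤ.- c′)
        (subst₂ (Cg (u * p)) (sym (rearrange (+ u) x z a c)) (sym (rearrange (+ u) x′ z′ a′ c′)) e₁) ,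
      cg-coarsen v r (y ℤ.- w) (y′ ℤ.- w′) (b ℤ.- d) (b′ ℤ.- d′)
        (subst₂ (Cg (v * r)) (sym (rearrange (+ v) y w b d)) (sym (rearrange (+ v) y′ w′ b′ d′)) e₂)

    cancel : ∀ P Q A B A′ B′ → Same (u * p) (v * r) (P ▹ A ⊖ Q ▹ B) (P ▹ A′ ⊖ Q ▹ B′) →
             Same p r (A ⊖ B) (A′ ⊖ B′)
    cancel (x , y) (z , w) (a , b) (c , d) (a′ , b′) (c′ , d′) (e₁ , e₂) =
      cg-cancel u p (x ℤ.- z) (a ℤ.- c) (a′ ℤ.- c′)
        (subst₂ (Cg (u * p)) (sym (rearrange (+ u) x z a c)) (sym (rearrange (+ u) x z a′ c′)) e₁) ,
      cg-cancel v r (y ℤ.- w) (b ℤ.- d) (b′ ℤ.- d′)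
        (subst₂ (Cg (v * r)) (sym (rearrange (+ v) y w b d)) (sym (rearrange (+ v) y w b′ d′)) e₂)

  private
    same-block : ∀ i j d e a b → (i , a) ≡ (j , b) → Valid a →
      Same (u * p) (v * r) (diff (h (inj₁ (i , d))) a) (diff (h (inj₁ (j , e))) b) → d ≡ e
    same-block i _ d e a@(κ , s , t) _ refl va eh = D.inj d e s t (valid⇒≢ κ va)
      (cancel (F.h i κ s) (F.h i κ t) (D.entry d s) (D.entry d t) (D.entry e s) (D.entry e t) eh)

    glue : ∀ {i j d e} {a b : Slot} → (i , a) ≡ (j , b) → d ≡ e →
           _≡_ {A = Ix × Slot} (inj₁ (i , d) , a) (inj₁ (j , e) , b)
    glue refl refl = refl

  -- After reduction to Z_u × Z_v, `F.inj` identifies the index of `F` and the slot; then the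
  -- quotient parts cancel and the matrix identifies the column. In a mixed collision the reduction
  -- would make a difference of `F` vanish, against `F.off`.
  inj : ∀ i j a b → Valid a → Valid b → Same m n (diff (g i) a) (diff (g j) b) →
        Same (u * p) (v * r) (diff (h i) a) (diff (h j) b) → (i , a) ≡ (j , b)
  inj (inj₁ (i , d)) (inj₁ (j , e)) a@(κ , s , t) b@(λ′ , s′ , t′) va vb eg eh =
    glue eq (same-block i j d e a b eq va eh)
    where
    eq : (i , a) ≡ (j , b)
    eq = F.inj i j a b va vb eg
           (coarsen (F.h i κ s) (F.h i κ t) (F.h j λ′ s′) (F.h j λ′ t′)
                    (D.entry d s) (D.entry d t) (D.entry e s′) (D.entry e t′) eh)
  inj (inj₂ i) (inj₂ j) a@(κ , s , t) b@(λ′ , s′ , t′) va vb eg eh =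
    cong (λ (i , a) → inj₂ i , a) (F′.inj i j a b va vb eg
      (cancel O O (F′.h i κ s) (F′.h i κ t) (F′.h j λ′ s′) (F′.h j λ′ t′) eh))
  inj (inj₁ (i , d)) (inj₂ j) a@(κ , s , t) (λ′ , s′ , t′) va vb eg eh =
    ⊥-elim (F.off i a va (coarsen (F.h i κ s) (F.h i κ t) O O
      (D.entry d s) (D.entry d t) (F′.h j λ′ s′) (F′.h j λ′ t′) eh))
  inj (inj₂ i) (inj₁ (j , d)) (κ , s , t) b@(λ′ , s′ , t′) va vb eg (e₁ , e₂) =
    ⊥-elim (F.off j b vb (coarsen (F.h j λ′ s′) (F.h j λ′ t′) O O
      (D.entry d s′) (D.entry d t′) (F′.h i κ s) (F′.h i κ t) (cg-sym e₁ , cg-sym e₂)))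

  private
    zero-form : ∀ u → 0ℤ ≡ (0ℤ ℤ.+ u ℤ.* 0ℤ) ℤ.- (0ℤ ℤ.+ u ℤ.* 0ℤ)
    zero-form = solve-∀

    -- Zero takes the shape of a difference of shifted points, to which `coarsen` and `cancel`
    -- apply.
    to-zero : ∀ {P} → Same (u * p) (v * r) P O → Same (u * p) (v * r) P (O ▹ O ⊖ O ▹ O)
    to-zero {P} (e₁ , e₂) =
      subst (Cg (u * p) (proj₁ P)) (zero-form (+ u)) e₁ , subst (Cg (v * r) (proj₂ P)) (zero-form (+ v)) e₂

  off : ∀ i a → Valid a → ¬ Same (u * p) (v * r) (diff (h i) a) (0ℤ , 0ℤ)
  off (inj₁ (i , d)) a@(κ , s , t) va e =
    F.off i a va (coarsen (F.h i κ s) (F.h i κ t) O O (D.entry d s) (D.entry d t) O O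
      (to-zero {F.h i κ s ▹ D.entry d s ⊖ F.h i κ t ▹ D.entry d t} e))
  off (inj₂ i) a@(κ , s , t) va e =
    F′.off i a va (cancel O O (F′.h i κ s) (F′.h i κ t) O O
      (to-zero {O ▹ F′.h i κ s ⊖ O ▹ F′.h i κ t} e))

  unique : Unique ixs
  unique = Unique.++⁺ (Unique.map⁺ (λ { refl → refl }) (Unique.cartesianProduct⁺ F.unique D.unique))
                      (Unique.map⁺ (λ { refl → refl }) F′.unique)
                      (λ (x , y) → disjoint (∈-map⁻ inj₁ x) (∈-map⁻ inj₂ y))
    where
    disjoint : ∀ {z : Ix} → (∃ λ x → _ × z ≡ inj₁ x) → (∃ λ y → _ × z ≡ inj₂ y) → ⊥
    disjoint (_ , _ , refl) (_ , _ , ())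

  -- In subtractive form: q (u v - 1) p r + q (p r - 1) = q (u v p r - 1).
  size : q ℕ.+ length ixs ≡ q * ((u * p) * (v * r))
  size = begin
    q ℕ.+ length ixs
      ≡⟨ cong (q ℕ.+_) (trans (length-++ (map inj₁ (cartesianProduct F.ixs D.ixs)))
           (cong₂ ℕ._+_ (trans (length-map inj₁ (cartesianProduct F.ixs D.ixs)) (trans (length-cartesianProduct F.ixs D.ixs) (cong (length F.ixs *_) D.size))) (length-map inj₂ F′.ixs))) ⟩
    q ℕ.+ (length F.ixs * (p * r) ℕ.+ length F′.ixs)
      ≡⟨ lem₁ q (length F.ixs * (p * r)) (length F′.ixs) ⟩
    (q ℕ.+ length F′.ixs) ℕ.+ length F.ixs * (p * r)
      ≡⟨ cong (ℕ._+ length F.ixs * (p * r)) F′.size ⟩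
    q * (p * r) ℕ.+ length F.ixs * (p * r)
      ≡⟨ sym (ℕ.*-distribʳ-+ (p * r) q (length F.ixs)) ⟩
    (q ℕ.+ length F.ixs) * (p * r)
      ≡⟨ cong (_* (p * r)) F.size ⟩
    q * (u * v) * (p * r)
      ≡⟨ lem₂ q u v p r ⟩
    q * ((u * p) * (v * r)) ∎
    where
    open ≡-Reasoning
    lem₁ : ∀ a b c → a ℕ.+ (b ℕ.+ c) ≡ (a ℕ.+ c) ℕ.+ b
    lem₁ = ℕSolver.solve-∀
    lem₂ : ∀ q u v p r → q * (u * v) * (p * r) ≡ q * ((u * p) * (v * r))
    lem₂ = ℕSolver.solve-∀

  lift : Fam m n q (u * p) (v * r)
  lift = record { Ix = Ix ; ixs = ixs ; unique = unique ; size = size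
                ; g = g ; h = h ; inj = inj ; off = off }

-- Residues of differences

cg-%ℕ : ∀ n .{{_ : NonZero n}} a b → Cg n (+ a) (+ b) → a % n ≡ b % n
cg-%ℕ n a b (+ k , e) = trans (cong (_% n) (ℤ.+-injective (trans e (cong (λ z → + b ℤ.+ z) (sym (ℤ.pos-* k n))))))
  (ℕ.[m+kn]%n≡m%n b k n)
cg-%ℕ n a b (-[1+ k ] , e) = sym (trans (cong (_% n) (ℤ.+-injective eq)) (ℕ.[m+kn]%n≡m%n a (suc k) n))
  where
  eq : + b ≡ + (a ℕ.+ suc k * n)
  eq = begin
    + b                                                          ≡⟨ lem (+ b) (+ suc k) (+ n) ⟩
    (+ b ℤ.+ (ℤ.- (+ suc k)) ℤ.* + n) ℤ.+ + suc k ℤ.* + n        ≡⟨ cong (ℤ._+ + suc k ℤ.* + n) (sym e) ⟩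
    + a ℤ.+ + suc k ℤ.* + n                                      ≡⟨ cong (λ z → + a ℤ.+ z) (sym (ℤ.pos-* (suc k) n)) ⟩
    + (a ℕ.+ suc k * n)                                          ∎
    where
    open ≡-Reasoning
    lem : ∀ b k n → b ≡ (b ℤ.+ (ℤ.- k) ℤ.* n) ℤ.+ k ℤ.* n
    lem = solve-∀

-- The product of `b` and n - 1 stands for -b; this avoids truncated subtraction, whatever the size
-- of `b`.
res : (n : ℕ) .{{_ : NonZero n}} → ℕ → ℕ → ℕ
res n a b = (a ℕ.+ b * (n ℕ.∸ 1)) % n

res-cg : ∀ n .{{_ : NonZero n}} a b → Cg n (+ (a ℕ.+ b * (n ℕ.∸ 1))) (+ a ℤ.- + b)
res-cg (suc k) a b = + b , (begin
  + (a ℕ.+ b * k)                             ≡⟨ cong (λ z → + a ℤ.+ z) (ℤ.pos-* b k) ⟩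
  + a ℤ.+ + b ℤ.* + k                         ≡⟨ lem (+ a) (+ b) (+ k) ⟩
  (+ a ℤ.- + b) ℤ.+ + b ℤ.* (+ 1 ℤ.+ + k)     ∎)
  where
  open ≡-Reasoning
  lem : ∀ a b k → a ℤ.+ b ℤ.* k ≡ (a ℤ.- b) ℤ.+ b ℤ.* (+ 1 ℤ.+ k)
  lem = solve-∀

res-cong : ∀ n .{{_ : NonZero n}} a b c d → Cg n (+ a ℤ.- + b) (+ c ℤ.- + d) → res n a b ≡ res n c d
res-cong n a b c d e = cg-%ℕ n _ _ (cg-trans (res-cg n a b) (cg-trans e (cg-sym (res-cg n c d))))

-- Decision by computation

T-∧⁻ : ∀ {a b} → T (a ∧ b) → T a × T b
T-∧⁻ = Equivalence.to T-∧

all-sound : ∀ {A : Set} (p : A → Bool) xs → T (all p xs) → ∀ {x} → x ∈ xs → T (p x)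
all-sound p (x ∷ xs) t (here refl) = proj₁ (T-∧⁻ {p x} t)
all-sound p (x ∷ xs) t (there m)   = all-sound p xs (proj₂ (T-∧⁻ {p x} t)) m

T-not⁻ : ∀ {b} → T (not b) → ¬ T b
T-not⁻ {false} _ ()

distinct : List ℕ → Bool
distinct []       = true
distinct (x ∷ xs) = all (λ y → not (x ≡ᵇ y)) xs ∧ distinct xs

distinct⇒Unique : ∀ xs → T (distinct xs) → Unique xs
distinct⇒Unique []       _ = []
distinct⇒Unique (x ∷ xs) t with T-∧⁻ {all (λ y → not (x ≡ᵇ y)) xs} t
... | p , q = All.tabulate (λ {y} m e → T-not⁻ (all-sound (λ y → not (x ≡ᵇ y)) xs p m) (ℕ.≡⇒≡ᵇ x y e))
            ∷ distinct⇒Unique xs q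

-- The same test, made faster by sorting into residue classes modulo 32 first.
bucket : ℕ → List ℕ → List ℕ
bucket b = filter (λ x → T? (x % 32 ≡ᵇ b))

distinct₃₂ : List ℕ → Bool
distinct₃₂ xs = all (λ b → distinct (bucket b xs)) (upTo 32)

-- Equal entries share a residue modulo 32, so a repetition would already occur inside one bucket.
unique-buckets : ∀ xs → (∀ {b} → b < 32 → Unique (bucket b xs)) → Unique xs
unique-buckets []       u = []
unique-buckets (x ∷ xs) u = All.tabulate apart ∷ unique-buckets xs rest
  where
  own : Unique (x ∷ bucket (x % 32) xs)
  own = subst Unique (filter-accept (λ y → T? (y % 32 ≡ᵇ x % 32)) {x} {xs} (ℕ.≡⇒≡ᵇ (x % 32) (x % 32) refl)) (u (ℕ.m%n<n x 32))
  apart : ∀ {y} → y ∈ xs → x ≢ y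
  apart {y} m refl = All.lookup (AllPairs.head own)
    (∈-filter⁺ (λ z → T? (z % 32 ≡ᵇ x % 32)) m (ℕ.≡⇒≡ᵇ (x % 32) (x % 32) refl)) refl
  tail-unique : ∀ b → Dec (T (x % 32 ≡ᵇ b)) → Unique (bucket b (x ∷ xs)) → Unique (bucket b xs)
  tail-unique b (yes p) v = AllPairs.tail (subst Unique (filter-accept (λ y → T? (y % 32 ≡ᵇ b)) {x} {xs} p) v)
  tail-unique b (no ¬p) v = subst Unique (filter-reject (λ y → T? (y % 32 ≡ᵇ b)) {x} {xs} ¬p) v
  rest : ∀ {b} → b < 32 → Unique (bucket b xs)
  rest {b} b< = tail-unique b (T? (x % 32 ≡ᵇ b)) (u b<)

distinct₃₂⇒Unique : ∀ xs → T (distinct₃₂ xs) → Unique xs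
distinct₃₂⇒Unique xs t = unique-buckets xs (λ {b} b< →
  distinct⇒Unique (bucket b xs) (all-sound (λ b → distinct (bucket b xs)) (upTo 32) t (∈-upTo⁺ b<)))

disjoint : List ℕ → List ℕ → Bool
disjoint xs ys = all (λ x → all (λ y → not (x ≡ᵇ y)) ys) xs

disjoint-sound : ∀ xs ys → T (disjoint xs ys) → ∀ {x y} → x ∈ xs → y ∈ ys → x ≢ y
disjoint-sound xs ys t {x} {y} m n e =
  T-not⁻ (all-sound (λ y → not (x ≡ᵇ y)) ys (all-sound (λ x → all (λ y → not (x ≡ᵇ y)) ys) xs t m) n) (ℕ.≡⇒≡ᵇ x y e)

T-∧⁺ : ∀ {a b} → T a → T b → T (a ∧ b)
T-∧⁺ p q = Equivalence.from T-∧ (p , q)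

T-not⁺ : ∀ {b} → ¬ T b → T (not b)
T-not⁺ {false} _ = tt
T-not⁺ {true}  n = n tt

==⇒≡ : ∀ s t → T (s == t) → s ≡ t
==⇒≡ s t e = toℕ-injective (ℕ.≡ᵇ⇒≡ (toℕ s) (toℕ t) e)

valid-sym : ∀ κ s t → T (valid κ s t) → T (valid κ t s)
valid-sym κ s t v with T-∧⁻ {row κ s} v
... | p , v′ with T-∧⁻ {row κ t} v′
...   | q , ne = T-∧⁺ {row κ t} q (T-∧⁺ {row κ s} p
        (T-not⁺ (λ e → T-not⁻ ne (ℕ.≡⇒≡ᵇ (toℕ s) (toℕ t) (sym (ℕ.≡ᵇ⇒≡ (toℕ t) (toℕ s) e))))))

module _ {A B : Set} (f : A → B) where

  map-injective : ∀ xs → Unique (map f xs) → ∀ {x y} → x ∈ xs → y ∈ xs → f x ≡ f y → x ≡ y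
  map-injective (x ∷ xs) (p ∷ u) (here refl) (here refl) e = refl
  map-injective (x ∷ xs) (p ∷ u) (here refl) (there n)   e = ⊥-elim (All.lookup p (∈-map⁺ f n) e)
  map-injective (x ∷ xs) (p ∷ u) (there m)   (here refl) e = ⊥-elim (All.lookup p (∈-map⁺ f m) (sym e))
  map-injective (x ∷ xs) (p ∷ u) (there m)   (there n)   e = map-injective xs u m n e

  lookup-injective : ∀ xs → Unique (map f xs) → ∀ i j → f (lookup xs i) ≡ f (lookup xs j) → i ≡ j
  lookup-injective (x ∷ xs) (p ∷ u) zero    zero    e = refl
  lookup-injective (x ∷ xs) (p ∷ u) zero    (suc j) e = ⊥-elim (All.lookup p (∈-map⁺ f (∈-lookup {xs = xs} j)) e)
  lookup-injective (x ∷ xs) (p ∷ u) (suc i) zero    e = ⊥-elim (All.lookup p (∈-map⁺ f (∈-lookup {xs = xs} i)) (sym e))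
  lookup-injective (x ∷ xs) (p ∷ u) (suc i) (suc j) e = cong suc (lookup-injective xs u i j e)

unique-++ˡ : ∀ {A : Set} (xs : List A) {ys} → Unique (xs ++ ys) → Unique xs
unique-++ˡ []       u       = []
unique-++ˡ (x ∷ xs) (p ∷ u) = All.tabulate (λ m → All.lookup p (∈-++⁺ˡ m)) ∷ unique-++ˡ xs u

unique-++ʳ : ∀ {A : Set} (xs : List A) {ys} → Unique (xs ++ ys) → Unique ys
unique-++ʳ []       u       = u
unique-++ʳ (x ∷ xs) (p ∷ u) = unique-++ʳ xs u

unique-++-disjoint : ∀ {A : Set} (xs : List A) {ys} → Unique (xs ++ ys) → ∀ {x y} → x ∈ xs → y ∈ ys → x ≢ y
unique-++-disjoint (x ∷ xs) (p ∷ u) (here refl) n = All.lookup p (∈-++⁺ʳ xs n)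
unique-++-disjoint (x ∷ xs) (p ∷ u) (there m)   n = unique-++-disjoint xs u m n

module _ {A B C : Set} (f : A → B → C) (ys : List B) where

  table : List A → List C
  table = concatMap (λ x → map (f x) ys)

  private
    ∈-table : ∀ xs i {y} → y ∈ ys → f (lookup xs i) y ∈ table xs
    ∈-table (x ∷ xs) zero    m = ∈-++⁺ˡ (∈-map⁺ (f x) m)
    ∈-table (x ∷ xs) (suc i) m = ∈-++⁺ʳ (map (f x) ys) (∈-table xs i m)

  -- The table is the concatenation of one segment for each entry of `xs`. Without repetitions,
  -- equal values come from one segment and from one place in it.
  table-injective : ∀ xs → Unique (table xs) → ∀ i j {a b} → a ∈ ys → b ∈ ys →
    f (lookup xs i) a ≡ f (lookup xs j) b → (i , a) ≡ (j , b)
  table-injective (x ∷ xs) u zero zero m n e =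
    cong (zero ,_) (map-injective (f x) ys (unique-++ˡ (map (f x) ys) u) m n e)
  table-injective (x ∷ xs) u zero (suc j) m n e =
    ⊥-elim (unique-++-disjoint (map (f x) ys) u (∈-map⁺ (f x) m) (∈-table xs j n) e)
  table-injective (x ∷ xs) u (suc i) zero m n e =
    ⊥-elim (unique-++-disjoint (map (f x) ys) u (∈-map⁺ (f x) n) (∈-table xs i m) (sym e))
  table-injective (x ∷ xs) u (suc i) (suc j) m n e =
    cong (λ (i , a) → suc i , a) (table-injective xs (unique-++ʳ (map (f x) ys) u) i j m n e)

kinds : List Kind
kinds = five ∷ four ∷ []

∈-kinds : ∀ κ → κ ∈ kinds
∈-kinds five = here refl
∈-kinds four = there (here refl)

slots : List Slot
slots = filter (λ (κ , s , t) → T? (valid κ s t)) (cartesianProduct kinds (cartesianProduct (allFin 5) (allFin 5)))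

∈-slots : ∀ a → Valid a → a ∈ slots
∈-slots (κ , s , t) v = ∈-filter⁺ (λ (κ , s , t) → T? (valid κ s t))
  (∈-cartesianProduct⁺ (∈-kinds κ) (∈-cartesianProduct⁺ (∈-allFin s) (∈-allFin t))) v

-- Families given by tables

nthOr : {A : Set} → A → List A → ℕ → A
nthOr d []       _       = d
nthOr d (x ∷ xs) zero    = x
nthOr d (x ∷ xs) (suc i) = nthOr d xs i

nth : List ℕ → ℕ → ℕ
nth = nthOr 0

-- A row lists the five points of the first block, then the four of the second.
at : List ℕ → Kind → Fin 5 → ℕ
at r five s = nth r (toℕ s)
at r four s = nth r (5 ℕ.+ toℕ s)

-- (a , b , x , y) is encoded as ((a n + b) u + x) v + y.
module Table (m n u v : ℕ) .{{_ : NonZero m}} .{{_ : NonZero n}} .{{_ : NonZero u}} .{{_ : NonZero v}} where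

  gPart hPart : ℕ → ℕ × ℕ
  gPart c = c / v / u / n , c / v / u % n
  hPart c = c / v % u , c % v

  point : ℕ × ℕ → Pt
  point (a , b) = + a , + b

  gKey hKey : ℕ × ℕ → ℕ × ℕ → ℕ
  gKey (a , b) (a′ , b′) = res m a a′ * n ℕ.+ res n b b′
  hKey (x , y) (x′ , y′) = res u x x′ * v ℕ.+ res v y y′

  gKey-cong : ∀ p q p′ q′ → Same m n (point p ⊖ point q) (point p′ ⊖ point q′) → gKey p q ≡ gKey p′ q′
  gKey-cong (a , b) (c , d) (a′ , b′) (c′ , d′) (e , f) =
    cong₂ (λ x y → x * n ℕ.+ y) (res-cong m a c a′ c′ e) (res-cong n b d b′ d′ f)

  hKey-cong : ∀ p q p′ q′ → Same u v (point p ⊖ point q) (point p′ ⊖ point q′) → hKey p q ≡ hKey p′ q′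
  hKey-cong (a , b) (c , d) (a′ , b′) (c′ , d′) (e , f) =
    cong₂ (λ x y → x * v ℕ.+ y) (res-cong u a c a′ c′ e) (res-cong v b d b′ d′ f)

  -- A difference in all four components becomes one number in mixed radix. Congruent differences
  -- have equal keys, so a list of distinct numbers certifies injectivity.
  key : List ℕ → Slot → ℕ
  key r (κ , s , t) = gKey (gPart (at r κ s)) (gPart (at r κ t)) * (u * v) ℕ.+ hKey (hPart (at r κ s)) (hPart (at r κ t))

  isOff : List ℕ → Slot → Bool
  isOff r (κ , s , t) = not (hKey (hPart (at r κ s)) (hPart (at r κ t)) ≡ᵇ hKey (0 , 0) (0 , 0))

  offTest : List (List ℕ) → Bool
  offTest = all (λ r → all (isOff r) slots)

  g h : List ℕ → Block
  g r κ s = point (gPart (at r κ s))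
  h r κ s = point (hPart (at r κ s))

  key-cong : ∀ r r′ a b → Same m n (diff (g r) a) (diff (g r′) b) → Same u v (diff (h r) a) (diff (h r′) b) →
             key r a ≡ key r′ b
  key-cong r r′ (κ , s , t) (κ′ , s′ , t′) eg eh = cong₂ (λ x y → x * (u * v) ℕ.+ y)
    (gKey-cong (gPart (at r κ s)) (gPart (at r κ t)) (gPart (at r′ κ′ s′)) (gPart (at r′ κ′ t′)) eg)
    (hKey-cong (hPart (at r κ s)) (hPart (at r κ t)) (hPart (at r′ κ′ s′)) (hPart (at r′ κ′ t′)) eh)

  inj : ∀ rs → T (distinct₃₂ (table key slots rs)) → ∀ i j a b → Valid a → Valid b →
        Same m n (diff (g (lookup rs i)) a) (diff (g (lookup rs j)) b) →
        Same u v (diff (h (lookup rs i)) a) (diff (h (lookup rs j)) b) → (i , a) ≡ (j , b)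
  inj rs d i j a b va vb eg eh = table-injective key slots rs (distinct₃₂⇒Unique (table key slots rs) d) i j
    (∈-slots a va) (∈-slots b vb) (key-cong (lookup rs i) (lookup rs j) a b eg eh)

  fam : ∀ q rs → q ℕ.+ length rs ≡ q * (u * v) → T (distinct₃₂ (table key slots rs)) → T (offTest rs) → Fam m n q u v
  fam q rs l d o = record
    { Ix = Fin (length rs)
    ; ixs = allFin (length rs)
    ; unique = Unique.allFin⁺ (length rs)
    ; size = trans (cong (q ℕ.+_) (length-tabulate (λ (i : Fin (length rs)) → i))) l
    ; g = λ i → g (lookup rs i)
    ; h = λ i → h (lookup rs i)
    ; inj = inj rs d
    ; off = λ { i a@(κ , s , t) va e → let r = lookup rs i in
        T-not⁻ (all-sound (isOff r) slots (all-sound (λ r → all (isOff r) slots) rs o (∈-lookup {xs = rs} i)) (∈-slots a va))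
          (ℕ.≡⇒≡ᵇ (hKey (hPart (at r κ s)) (hPart (at r κ t))) (hKey (0 , 0) (0 , 0)) (hKey-cong (hPart (at r κ s)) (hPart (at r κ t)) (0 , 0) (0 , 0) e)) }
    }

module MatrixTable (p r : ℕ) .{{_ : NonZero p}} .{{_ : NonZero r}} where

  -- With a trivial first factor an entry (x , y) is coded x r + y.
  open Table 1 1 p r using (hPart; point; hKey; hKey-cong)

  key : Fin 5 → Fin 5 → List ℕ → ℕ
  key s t d = hKey (hPart (nth d (toℕ s))) (hPart (nth d (toℕ t)))

  test : List (List ℕ) → Bool
  test rs = all (λ (κ , s , t) → distinct (map (key s t) rs)) slots

  private
    ≢⇒valid : ∀ s t → s ≢ t → T (valid five s t)
    ≢⇒valid s t ne = T-not⁺ (λ e → ne (==⇒≡ s t e))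

  diffMatrix : ∀ rs → length rs ≡ p * r → T (test rs) → DiffMatrix p r
  diffMatrix rs l ok = record
    { Ix = Fin (length rs)
    ; ixs = allFin (length rs)
    ; unique = Unique.allFin⁺ (length rs)
    ; size = trans (length-tabulate (λ (i : Fin (length rs)) → i)) l
    ; entry = λ i s → point (hPart (nth (lookup rs i) (toℕ s)))
    ; inj = λ d e s t ne c → lookup-injective (key s t) rs
        (distinct⇒Unique _ (all-sound (λ (κ , s , t) → distinct (map (key s t) rs)) slots ok (∈-slots (five , s , t) (≢⇒valid s t ne))))
        d e (hKey-cong (hPart (nth (lookup rs d) (toℕ s))) (hPart (nth (lookup rs d) (toℕ t)))
                       (hPart (nth (lookup rs e) (toℕ s))) (hPart (nth (lookup rs e) (toℕ t))) c)
    }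

-- Doubling modulo w

%≡⇒ : ∀ w .{{_ : NonZero w}} a b → a % w ≡ b % w → a ≤ b → w ∣ b ℕ.∸ a
%≡⇒ w a b e a≤b = divides (b / w ℕ.∸ a / w) (begin
  b ℕ.∸ a                                             ≡⟨ cong₂ ℕ._∸_ (ℕ.m≡m%n+[m/n]*n b w) (ℕ.m≡m%n+[m/n]*n a w) ⟩
  (b % w ℕ.+ b / w * w) ℕ.∸ (a % w ℕ.+ a / w * w)     ≡⟨ cong (λ z → (b % w ℕ.+ b / w * w) ℕ.∸ (z ℕ.+ a / w * w)) e ⟩
  (b % w ℕ.+ b / w * w) ℕ.∸ (b % w ℕ.+ a / w * w)     ≡⟨ ℕ.[m+n]∸[m+o]≡n∸o (b % w) (b / w * w) (a / w * w) ⟩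
  b / w * w ℕ.∸ a / w * w                             ≡⟨ sym (ℕ.*-distribʳ-∸ w (b / w) (a / w)) ⟩
  (b / w ℕ.∸ a / w) * w                               ∎)
  where open ≡-Reasoning

module Doubling (A-1 w : ℕ) .{{_ : NonZero w}} (coprime : Coprime w (suc A-1)) where

  A : ℕ
  A = suc A-1

  InRange : ℕ → Set
  InRange y = (0 < y) × (y < w)

  ∤A* : ∀ {y} → InRange y → ¬ (w ∣ A * y)
  ∤A* {suc y} (_ , y<w) d = ℕ.<⇒≱ y<w (∣⇒≤ (coprime-divisor coprime d))

  -- Multiplication by the cofactor `c` turns m z into A z, so coprimality to `A` alone serves for
  -- every divisor of `A`.
  cancel-∣ : ∀ m c → m * c ≡ A → ∀ {z} → w ∣ m * z → w ∣ z
  cancel-∣ m c e {z} d = coprime-divisor coprime (subst (w ∣_) eq (∣-trans d (m∣m*n c)))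
    where
    eq : m * z * c ≡ A * z
    eq = trans (lem m z c) (cong (_* z) e)
      where
      lem : ∀ m z c → m * z * c ≡ m * c * z
      lem = ℕSolver.solve-∀

  ≡-of-∣ : ∀ {y z} → y < w → z < w → y ≤ z → w ∣ z ℕ.∸ y → y ≡ z
  ≡-of-∣ {y} {z} y<w z<w y≤z d with z ℕ.∸ y in eq
  ... | zero  = ℕ.≤-antisym y≤z (ℕ.m∸n≡0⇒m≤n eq)
  ... | suc k = ⊥-elim (ℕ.<⇒≱ (ℕ.≤-<-trans (ℕ.m∸n≤m z y) z<w) (ℕ.≤-trans (∣⇒≤ d) (ℕ.≤-reflexive (sym eq))))

  cancel : ∀ m c → m * c ≡ A → ∀ {y z} → y < w → z < w → m * y % w ≡ m * z % w → y ≡ z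
  cancel m c e {y} {z} y<w z<w eq with ℕ.≤-total y z
  ... | inj₁ y≤z = ≡-of-∣ y<w z<w y≤z (cancel-∣ m c e
          (subst (w ∣_) (sym (ℕ.*-distribˡ-∸ m z y)) (%≡⇒ w (m * y) (m * z) eq (ℕ.*-monoʳ-≤ m y≤z))))
  ... | inj₂ z≤y = sym (≡-of-∣ z<w y<w z≤y (cancel-∣ m c e
          (subst (w ∣_) (sym (ℕ.*-distribˡ-∸ m y z)) (%≡⇒ w (m * z) (m * y) (sym eq) (ℕ.*-monoʳ-≤ m z≤y)))))

  -- Strict bounds on both sides are possible because, by `∤A*`, no nonzero residue is an endpoint
  -- of an arc. Hence reflection and doubling act on arcs without boundary cases.
  record At (k y : ℕ) : Set where
    constructor at⟨_,_⟩
    field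
      lower : k * w < A * y
      upper : A * y < suc k * w

  abstract
    -- The position of y on a circle of length w divided into A arcs.
    arc : ℕ → ℕ
    arc y = A * y / w

    arc-At : ∀ {y} → InRange y → At (arc y) y
    arc-At {y} r = at⟨ ℕ.≤∧≢⇒< (ℕ.m/n*n≤m (A * y) w) (λ e → ∤A* r (divides (arc y) (sym e)))
                     , ℕ.≤-<-trans (ℕ.≤-reflexive (ℕ.m≡m%n+[m/n]*n (A * y) w)) (ℕ.+-monoˡ-< (arc y * w) (ℕ.m%n<n (A * y) w)) ⟩

    at-≤ : ∀ {j k a b} → j * w < a → a ≤ b → b < suc k * w → j ≤ k
    at-≤ {j} {k} l e u = ℕ.s≤s⁻¹ (ℕ.*-cancelʳ-< w j (suc k) (ℕ.<-trans (ℕ.<-≤-trans l e) u))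

    At-unique : ∀ {j k y} → At j y → At k y → j ≡ k
    At-unique at⟨ l , u ⟩ at⟨ l′ , u′ ⟩ = ℕ.≤-antisym (at-≤ l ℕ.≤-refl u′) (at-≤ l′ ℕ.≤-refl u)

    arc<A : ∀ {y} → InRange y → arc y < A
    arc<A {y} r@(_ , y<w) = ℕ.*-cancelʳ-< w (arc y) A (ℕ.<-trans (At.lower (arc-At r)) (ℕ.*-monoʳ-< A y<w))

    -- Reflection reverses the order of the arcs: the bounds for w - y arise from those for y by
    -- subtraction from A w.
    arc-neg : ∀ {y} → InRange y → arc (w ℕ.∸ y) ≡ A-1 ℕ.∸ arc y
    arc-neg {y} r@(0<y , y<w) = At-unique (arc-At (ℕ.m<n⇒0<n∸m y<w , ℕ.∸-monoʳ-< 0<y (ℕ.<⇒≤ y<w))) at⟨ lo , up ⟩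
      where
      k : ℕ
      k = arc y
      k≤A-1 : k ≤ A-1
      k≤A-1 = ℕ.s≤s⁻¹ (arc<A r)
      e₁ : A * (w ℕ.∸ y) ℕ.+ A * y ≡ A * w
      e₁ = trans (sym (ℕ.*-distribˡ-+ A (w ℕ.∸ y) y)) (cong (A *_) (ℕ.m∸n+n≡m (ℕ.<⇒≤ y<w)))
      e₂ : (A-1 ℕ.∸ k) * w ℕ.+ suc k * w ≡ A * w
      e₂ = trans (sym (ℕ.*-distribʳ-+ w (A-1 ℕ.∸ k) (suc k)))
            (cong (_* w) (trans (ℕ.+-suc (A-1 ℕ.∸ k) k) (cong suc (ℕ.m∸n+n≡m k≤A-1))))
      e₃ : suc (A-1 ℕ.∸ k) * w ℕ.+ k * w ≡ A * w
      e₃ = trans (sym (ℕ.*-distribʳ-+ w (suc (A-1 ℕ.∸ k)) k)) (cong (λ z → suc z * w) (ℕ.m∸n+n≡m k≤A-1))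
      lo : (A-1 ℕ.∸ k) * w < A * (w ℕ.∸ y)
      lo = ℕ.+-cancelʳ-< (A * y) _ _ (ℕ.<-≤-trans (ℕ.+-monoʳ-< ((A-1 ℕ.∸ k) * w) (At.upper (arc-At r)))
             (ℕ.≤-reflexive (trans e₂ (sym e₁))))
      up : A * (w ℕ.∸ y) < suc (A-1 ℕ.∸ k) * w
      up = ℕ.+-cancelʳ-< (k * w) _ _ (ℕ.<-≤-trans (ℕ.+-monoʳ-< (A * (w ℕ.∸ y)) (At.lower (arc-At r)))
             (ℕ.≤-reflexive (trans e₁ (sym e₃))))

    private
      split : ∀ {y z} → InRange y → InRange z → z % w ≡ 2 * y % w → (2 * y ≡ z) ⊎ (2 * y ≡ z ℕ.+ w)
      split {y} {z} (_ , y<w) (_ , z<w) e with 2 * y ℕ.<? w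
      ... | yes p = inj₁ (trans (sym (ℕ.m<n⇒m%n≡m p)) (trans (sym e) (ℕ.m<n⇒m%n≡m z<w)))
      ... | no ¬p = inj₂ (trans (sym (ℕ.m∸n+n≡m w≤)) (cong (ℕ._+ w) (trans (sym (ℕ.m<n⇒m%n≡m lt))
                      (trans (ℕ.m≤n⇒[n∸m]%m≡n%m w≤) (trans (sym e) (ℕ.m<n⇒m%n≡m z<w))))))
        where
        w≤ : w ≤ 2 * y
        w≤ = ℕ.≮⇒≥ ¬p
        lt : 2 * y ℕ.∸ w < w
        lt = ℕ.+-cancelʳ-< w _ _ (ℕ.<-≤-trans (ℕ.≤-<-trans (ℕ.≤-reflexive (ℕ.m∸n+n≡m w≤)) (ℕ.*-monoʳ-< 2 y<w))
               (ℕ.≤-reflexive (cong (w ℕ.+_) (ℕ.+-identityʳ w))))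

      between : ∀ j k → 2 * k ≤ j → j ≤ suc (2 * k) → ∃ λ b → b < 2 × j ≡ 2 * k ℕ.+ b
      between j k l u with ℕ.m≤n⇒m<n∨m≡n l
      ... | inj₁ lt = 1 , s≤s z<s , ℕ.≤-antisym (ℕ.≤-trans u (ℕ.≤-reflexive (ℕ.+-comm 1 (2 * k)))) (ℕ.≤-trans (ℕ.≤-reflexive (ℕ.+-comm (2 * k) 1)) lt)
      ... | inj₂ eq = 0 , z<s , trans (sym eq) (sym (ℕ.+-identityʳ (2 * k)))

      arcs : ∀ {k j y a} → At k y → j * w < a → a < suc j * w → a ≡ A * (2 * y) → ∃ λ b → b < 2 × j ≡ 2 * k ℕ.+ b
      arcs {k} {j} {y} at⟨ l , u ⟩ l′ u′ refl = between j k
        (at-≤ {b = A * (2 * y)} (ℕ.<-≤-trans (ℕ.≤-<-trans (ℕ.≤-reflexive (ℕ.*-assoc 2 k w)) (ℕ.*-monoʳ-< 2 l)) (ℕ.≤-reflexive (swp y))) ℕ.≤-refl u′)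
        (at-≤ {b = A * (2 * y)} l′ ℕ.≤-refl (ℕ.≤-<-trans (ℕ.≤-reflexive (sym (swp y))) (ℕ.<-≤-trans (ℕ.*-monoʳ-< 2 u) (ℕ.≤-reflexive (lem k w)))))
        where
        swp : ∀ y → 2 * (A * y) ≡ A * (2 * y)
        swp = comm A
          where
          comm : ∀ a y → 2 * (a * y) ≡ a * (2 * y)
          comm = ℕSolver.solve-∀
        lem : ∀ k w → 2 * (w ℕ.+ k * w) ≡ suc (suc (2 * k)) * w
        lem = ℕSolver.solve-∀

    -- Twice the bounds of arc k are 2 k w and (2 k + 2) w, which enclose two arcs; `b` tells which
    -- of them is met. Reduction modulo `A` accounts for a full turn of the circle.
    arc-double : ∀ {y z} → InRange y → InRange z → z % w ≡ 2 * y % w → ∃ λ b → b < 2 × arc z ≡ (2 * arc y ℕ.+ b) % A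
    arc-double {y} {z} ry rz e with split ry rz e
    ... | inj₁ eq with arcs {j = arc z} (arc-At ry) (At.lower (arc-At rz)) (At.upper (arc-At rz)) (cong (A *_) (sym eq))
    ...   | b , b<2 , f = b , b<2 , trans (sym (ℕ.m<n⇒m%n≡m (arc<A rz))) (cong (_% A) f)
    -- Here 2 y = z + w has passed the origin, so the arc of z is moved on by `A` before the bounds
    -- are compared.
    arc-double {y} {z} ry rz e | inj₂ eq
      with arcs {j = arc z ℕ.+ A} {a = A * z ℕ.+ A * w} (arc-At ry)
             (ℕ.≤-<-trans (ℕ.≤-reflexive (ℕ.*-distribʳ-+ w (arc z) A)) (ℕ.+-monoˡ-< (A * w) (At.lower (arc-At rz))))
             (ℕ.<-≤-trans (ℕ.+-monoˡ-< (A * w) (At.upper (arc-At rz))) (ℕ.≤-reflexive (sym (ℕ.*-distribʳ-+ w (suc (arc z)) A))))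
             (trans (sym (ℕ.*-distribˡ-+ A z w)) (cong (A *_) (sym eq)))
    ...   | b , b<2 , f = b , b<2 , trans (sym (ℕ.m<n⇒m%n≡m (arc<A rz))) (trans (sym (ℕ.[m+n]%n≡m%n (arc z) A)) (cong (_% A) f))

-- Families from doubling

-- A signed type: its sign and the number of the type.
Type : Set
Type = Bool × ℕ

opposite : Type → Type
opposite (b , t) = not b , t

signs : List Bool
signs = true ∷ false ∷ []

types : List Type
types = cartesianProduct signs (upTo 3)

-- A half-system is the union of the arcs (0, 1/3) and (1/2, 2/3).  Doubling
-- leaves it exactly from the arc (1/6, 1/4); there type 2 is used, type 1 is
-- used on the part of the half-system whose double lies in that arc, and
-- type 0 elsewhere.
arcTypes : List Type
arcTypes =
  (true  , 0) ∷ (true  , 0) ∷ (true  , 1) ∷ (true  , 0) ∷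
  (true  , 2) ∷ (true  , 2) ∷ (true  , 0) ∷ (true  , 0) ∷
  (false , 0) ∷ (false , 1) ∷ (false , 0) ∷ (false , 0) ∷
  (true  , 0) ∷ (true  , 0) ∷ (true  , 1) ∷ (true  , 0) ∷
  (false , 0) ∷ (false , 0) ∷ (false , 2) ∷ (false , 2) ∷
  (false , 0) ∷ (false , 1) ∷ (false , 0) ∷ (false , 0) ∷ []

arcType : ℕ → Type
arcType = nthOr (true , 0) arcTypes

-- With `arc-neg` this gives y and w - y opposite types, the property that makes the positive arcs a
-- half-system.
arcType-opposite : ∀ {k} → k < 24 → arcType (23 ℕ.∸ k) ≡ opposite (arcType k)
arcType-opposite k<24 = All.lookup {P = λ k → arcType (23 ℕ.∸ k) ≡ opposite (arcType k)}
  (toWitness {a? = All.all? (λ k → ≡-dec Bool._≟_ ℕ._≟_ (arcType (23 ℕ.∸ k)) (opposite (arcType k))) (upTo 24)} tt)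
  (∈-upTo⁺ k<24)

arcType∈types : ∀ {k} → k < 24 → arcType k ∈ types
arcType∈types {k} k<24 = ∈-cartesianProduct⁺ (∈-signs (proj₁ (arcType k))) (∈-upTo⁺ (All.lookup {P = λ k → proj₂ (arcType k) < 3}
  (toWitness {a? = All.all? (λ k → proj₂ (arcType k) ℕ.<? 3) (upTo 24)} tt) (∈-upTo⁺ k<24)))
  where
  ∈-signs : ∀ b → b ∈ signs
  ∈-signs true  = here refl
  ∈-signs false = there (here refl)

-- Rows s > t of a block at y have their difference over (s - t) y. Five rows give the slopes 1 to
-- 4, all divisors of 24 and therefore invertible modulo w.
data Slope : ℕ → Set where
  one   : Slope 1
  two   : Slope 2
  three : Slope 3
  four  : Slope 4

slope : ∀ (s t : Fin 5) → toℕ t < toℕ s → Slope (toℕ s ℕ.∸ toℕ t)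
slope 1F 0F _ = one
slope 2F 0F _ = two
slope 3F 0F _ = three
slope 4F 0F _ = four
slope 2F 1F _ = one
slope 3F 1F _ = two
slope 4F 1F _ = three
slope 3F 2F _ = one
slope 4F 2F _ = two
slope 4F 3F _ = one
slope 1F 1F (s≤s ())
slope 1F 2F (s≤s ())
slope 1F 3F (s≤s ())
slope 1F 4F (s≤s ())
slope 2F 2F (s≤s (s≤s ()))
slope 2F 3F (s≤s (s≤s ()))
slope 2F 4F (s≤s (s≤s ()))
slope 3F 3F (s≤s (s≤s (s≤s ())))
slope 3F 4F (s≤s (s≤s (s≤s ())))
slope 4F 4F (s≤s (s≤s (s≤s (s≤s ()))))

rows-apart : ∀ κ s u → Valid (κ , s , u) → (toℕ u < toℕ s) ⊎ (toℕ s < toℕ u)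
rows-apart κ s u v with ℕ.<-cmp (toℕ u) (toℕ s)
... | tri< u<s _ _ = inj₁ u<s
... | tri> _ _ s<u = inj₂ s<u
... | tri≈ _ e _   = ⊥-elim (valid⇒≢ κ {s} {u} v (sym (toℕ-injective e)))

index-≡ : ∀ {r q} {j j′ : Fin r} {i i′ : Fin q} {a a′ : Slot} → j ≡ j′ × toℕ i ≡ toℕ i′ × a ≡ a′ →
          ((j , i) , a) ≡ ((j′ , i′) , a′)
index-≡ (refl , e , refl) = cong (λ i → (_ , i) , _) (toℕ-injective e)

-- blocks lists, for each of the three types, one row per index.
module Dynamic (m n q₀ : ℕ) .{{_ : NonZero m}} .{{_ : NonZero n}} (blocks : List (List (List ℕ))) where

  open Table m n 1 1 using (gPart; point; gKey; gKey-cong)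

  base : ℕ → ℕ → Kind → Fin 5 → ℕ × ℕ
  base t i κ s = gPart (at (nthOr [] (nthOr [] blocks t) i) κ s)

  -- Positions run over 1, ..., r, although the half-system may contain -y in place of y. The
  -- negative of a block at -y lies at y and has the same differences, which is why a negative type
  -- negates the base points.
  signed : Bool → Pt → Pt
  signed true  p       = p
  signed false (a , b) = ℤ.- a , ℤ.- b

  typed : Type → ℕ → Block
  typed (b , t) i κ s = signed b (point (base t i κ s))

  -- The difference of two negated points is the reversed difference, so a negative type exchanges
  -- the two rows and keys are computed from natural numbers alone.
  key : Type → ℕ → Slot → ℕ
  key (true  , t) i (κ , s , u) = gKey (base t i κ s) (base t i κ u)
  key (false , t) i (κ , s , u) = gKey (base t i κ u) (base t i κ s)

  key-opposite : ∀ τ i κ s u → key (opposite τ) i (κ , s , u) ≡ key τ i (κ , u , s)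
  key-opposite (true  , t) i κ s u = refl
  key-opposite (false , t) i κ s u = refl

  private
    arrange : Bool → ℕ × ℕ → ℕ × ℕ → (ℕ × ℕ) × (ℕ × ℕ)
    arrange true  p q = p , q
    arrange false p q = q , p

    Δ-of : (ℕ × ℕ) × (ℕ × ℕ) → Pt
    Δ-of (p , q) = point p ⊖ point q

    arrange-eq : ∀ b p q → signed b (point p) ⊖ signed b (point q) ≡ Δ-of (arrange b p q)
    arrange-eq true  p       q       = refl
    arrange-eq false (a , b) (c , d) = cong₂ _,_ (lem (+ a) (+ c)) (lem (+ b) (+ d))
      where
      lem : ∀ a c → (ℤ.- a) ℤ.- (ℤ.- c) ≡ c ℤ.- a
      lem = solve-∀

    key-arrange : ∀ b t i κ s u → let pq = arrange b (base t i κ s) (base t i κ u) in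
                  key (b , t) i (κ , s , u) ≡ gKey (proj₁ pq) (proj₂ pq)
    key-arrange true  t i κ s u = refl
    key-arrange false t i κ s u = refl

  key-cong : ∀ τ τ′ i i′ a a′ → Same m n (diff (typed τ i) a) (diff (typed τ′ i′) a′) → key τ i a ≡ key τ′ i′ a′
  key-cong (b , t) (b′ , t′) i i′ (κ , s , u) (κ′ , s′ , u′) e =
    let P  = arrange b (base t i κ s) (base t i κ u)
        P′ = arrange b′ (base t′ i′ κ′ s′) (base t′ i′ κ′ u′) in
    trans (key-arrange b t i κ s u) (trans
      (gKey-cong (proj₁ P) (proj₂ P) (proj₁ P′) (proj₂ P′) (subst₂ (Same m n)
        (arrange-eq b (base t i κ s) (base t i κ u)) (arrange-eq b′ (base t′ i′ κ′ s′) (base t′ i′ κ′ u′)) e))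
      (sym (key-arrange b′ t′ i′ κ′ s′ u′)))

  Hit : Set
  Hit = ℕ × Slot

  -- Descending pairs of rows suffice: an ascending pair at y is a descending pair at w - y, where
  -- the type is opposite.
  hits : ℕ → List Hit
  hits μ = filter (λ (i , κ , s , u) → T? (toℕ s ≡ᵇ μ ℕ.+ toℕ u)) (cartesianProduct (upTo q₀) slots)

  ∈-hits : ∀ {μ i} κ s u → i < q₀ → Valid (κ , s , u) → toℕ s ≡ μ ℕ.+ toℕ u → (i , κ , s , u) ∈ hits μ
  ∈-hits {μ} κ s u i< v e = ∈-filter⁺ (λ (i , κ , s , u) → T? (toℕ s ≡ᵇ μ ℕ.+ toℕ u))
    (∈-cartesianProduct⁺ (∈-upTo⁺ i<) (∈-slots (κ , s , u) v)) (ℕ.≡⇒≡ᵇ _ _ e)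

  hitKey : Type → Hit → ℕ
  hitKey τ (i , a) = key τ i a

  keys : Type → ℕ → List ℕ
  keys τ μ = map (hitKey τ) (hits μ)

  double : ℕ → ℕ → ℕ
  double k b = (2 * k ℕ.+ b) % 24

  -- If μ y = ν z modulo w, the slopes relate y to z. Equal slopes give y = z and hence one type.
  -- The slopes 1, 2 and 2, 4 give y = 2 z, while 1, 4 give y = 4 z, and `double` links the arcs. No
  -- doubling links slope 3 to the others, so `tripleTest` runs over all pairs of types.
  distinctTest doubleTest quadrupleTest tripleTest : Bool
  distinctTest = all (λ τ → all (λ μ → distinct (keys τ μ)) (1 ∷ 2 ∷ 3 ∷ 4 ∷ [])) types
  doubleTest = all (λ k → all (λ b →
    disjoint (keys (arcType (double k b)) 1) (keys (arcType k) 2) ∧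
    disjoint (keys (arcType (double k b)) 2) (keys (arcType k) 4)) (upTo 2)) (upTo 24)
  quadrupleTest = all (λ k → all (λ b → all (λ c →
    disjoint (keys (arcType (double (double k b) c)) 1) (keys (arcType k) 4)) (upTo 2)) (upTo 2)) (upTo 24)
  tripleTest = all (λ τ → all (λ τ′ → all (λ μ → disjoint (keys τ 3) (keys τ′ μ)) (1 ∷ 2 ∷ 4 ∷ [])) types) types

  -- As w = 2 r + 1, there are r positions, and the required q (w - 1) pairs amount to 2 q at each.
  module Family (q r : ℕ) (q₀≡2q : q₀ ≡ 2 * q) (coprime : Coprime (suc (2 * r)) 24)
                (ok₁ : T distinctTest) (ok₂ : T doubleTest) (ok₄ : T quadrupleTest) (ok₃ : T tripleTest) where

    w : ℕ
    w = suc (2 * r)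

    open Doubling 23 w coprime

    typeAt : ℕ → Type
    typeAt y = arcType (arc y)

    typeAt∈ : ∀ {y} → InRange y → typeAt y ∈ types
    typeAt∈ ry = arcType∈types (arc<A ry)

    distinct-keys : ∀ {τ μ} → τ ∈ types → Slope μ → T (distinct (keys τ μ))
    distinct-keys {τ} {μ} τ∈ sl = all-sound (λ μ → distinct (keys τ μ)) (1 ∷ 2 ∷ 3 ∷ 4 ∷ [])
      (all-sound (λ τ → all (λ μ → distinct (keys τ μ)) (1 ∷ 2 ∷ 3 ∷ 4 ∷ [])) types ok₁ τ∈) (μ∈ sl)
      where
      μ∈ : ∀ {μ} → Slope μ → μ ∈ (1 ∷ 2 ∷ 3 ∷ 4 ∷ [])
      μ∈ one   = here refl
      μ∈ two   = there (here refl)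
      μ∈ three = there (there (here refl))
      μ∈ four  = there (there (there (here refl)))

    double-disjoint : ∀ {k b} → k < 24 → b < 2 →
      T (disjoint (keys (arcType (double k b)) 1) (keys (arcType k) 2)) ×
      T (disjoint (keys (arcType (double k b)) 2) (keys (arcType k) 4))
    double-disjoint {k} {b} k< b< = T-∧⁻ {disjoint (keys (arcType (double k b)) 1) (keys (arcType k) 2)}
      (all-sound (test k) (upTo 2) (all-sound (λ k → all (test k) (upTo 2)) (upTo 24) ok₂ (∈-upTo⁺ k<)) (∈-upTo⁺ b<))
      where
      test : ℕ → ℕ → Bool
      test k b = disjoint (keys (arcType (double k b)) 1) (keys (arcType k) 2) ∧
                 disjoint (keys (arcType (double k b)) 2) (keys (arcType k) 4)

    quadruple-disjoint : ∀ {k b c} → k < 24 → b < 2 → c < 2 →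
      T (disjoint (keys (arcType (double (double k b) c)) 1) (keys (arcType k) 4))
    quadruple-disjoint {k} {b} {c} k< b< c< = all-sound (test k b) (upTo 2)
      (all-sound (λ b → all (test k b) (upTo 2)) (upTo 2)
        (all-sound (λ k → all (λ b → all (test k b) (upTo 2)) (upTo 2)) (upTo 24) ok₄ (∈-upTo⁺ k<)) (∈-upTo⁺ b<)) (∈-upTo⁺ c<)
      where
      test : ℕ → ℕ → ℕ → Bool
      test k b c = disjoint (keys (arcType (double (double k b) c)) 1) (keys (arcType k) 4)

    triple-disjoint : ∀ {τ τ′ μ} → τ ∈ types → τ′ ∈ types → μ ∈ (1 ∷ 2 ∷ 4 ∷ []) →
      T (disjoint (keys τ 3) (keys τ′ μ))
    triple-disjoint {τ} {τ′} τ∈ τ′∈ μ∈ = all-sound (λ μ → disjoint (keys τ 3) (keys τ′ μ)) (1 ∷ 2 ∷ 4 ∷ [])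
      (all-sound (test τ) types (all-sound (λ τ → all (test τ) types) types ok₃ τ∈) τ′∈) μ∈
      where
      test : Type → Type → Bool
      test τ τ′ = all (λ μ → disjoint (keys τ 3) (keys τ′ μ)) (1 ∷ 2 ∷ 4 ∷ [])

    twice : ℕ → ℕ
    twice y = 2 * y % w

    twice-range : ∀ {y} → InRange y → InRange (twice y)
    twice-range {y} ry = ℕ.n≢0⇒n>0 (λ e → ∤A* ry (subst (w ∣_) (lem y) (∣-trans′ (m%n≡0⇒n∣m (2 * y) w e)))) , ℕ.m%n<n (2 * y) w
      where
      ∣-trans′ : w ∣ 2 * y → w ∣ 12 * (2 * y)
      ∣-trans′ = ∣n⇒∣m*n 12
      lem : ∀ y → 12 * (2 * y) ≡ 24 * y
      lem = ℕSolver.solve-∀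

    twice-% : ∀ y → twice y % w ≡ 2 * y % w
    twice-% y = ℕ.m%n%n≡m%n (2 * y) w

    twice-twice : ∀ y → 2 * twice y % w ≡ 4 * y % w
    twice-twice y = begin
      2 * (2 * y % w) % w              ≡⟨ ℕ.%-distribˡ-* 2 (2 * y % w) w ⟩
      (2 % w) * (2 * y % w % w) % w    ≡⟨ cong (λ z → (2 % w) * z % w) (ℕ.m%n%n≡m%n (2 * y) w) ⟩
      (2 % w) * (2 * y % w) % w        ≡⟨ sym (ℕ.%-distribˡ-* 2 (2 * y) w) ⟩
      2 * (2 * y) % w                  ≡⟨ cong (_% w) (lem y) ⟩
      4 * y % w                        ∎
      where
      open ≡-Reasoning
      lem : ∀ y → 2 * (2 * y) ≡ 4 * y
      lem = ℕSolver.solve-∀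

    -- The normal form of a difference: it lies over `μ * y`, with y any nonzero residue, and
    -- `value` codes its part in the base group.
    record HitAt (μ : ℕ) : Set where
      field
        y     : ℕ
        range : InRange y
        hit   : Hit
        ∈hits : hit ∈ hits μ

      value : ℕ
      value = hitKey (typeAt y) hit

      value∈ : value ∈ keys (typeAt y) μ
      value∈ = ∈-map⁺ (hitKey (typeAt y)) ∈hits

    open HitAt

    private
      1*% : ∀ {y z} → 1 * y % w ≡ z → y % w ≡ z
      1*% {y} e = trans (cong (_% w) (sym (ℕ.*-identityˡ y))) e

      -- The position of `H` is twice that of `K`, so `arc-double` names the arc of `H` and
      -- `doubleTest` covers the pair.
      apart₁₂ : (H : HitAt 1) (K : HitAt 2) → 1 * y H % w ≡ 2 * y K % w → value H ≢ value K
      apart₁₂ H K e = let b , b< , f = arc-double (range K) (range H) (1*% {y H} e) in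
        disjoint-sound _ _ (proj₁ (double-disjoint (arc<A (range K)) b<))
          (subst (λ k → value H ∈ keys (arcType k) 1) f (value∈ H)) (value∈ K)

      apart₂₄ : (H : HitAt 2) (K : HitAt 4) → 2 * y H % w ≡ 4 * y K % w → value H ≢ value K
      apart₂₄ H K e =
        -- Since 2 is invertible, with cofactor 12 in 24, 2 y = 4 z gives y = 2 z.
        let b , b< , f = arc-double (range K) (range H) (trans (cong (_% w)
              (cancel 2 12 refl (proj₂ (range H)) (proj₂ (twice-range (range K))) (trans e (sym (twice-twice (y K)))))) (twice-% (y K))) in
        disjoint-sound _ _ (proj₂ (double-disjoint (arc<A (range K)) b<))
          (subst (λ k → value H ∈ keys (arcType k) 2) f (value∈ H)) (value∈ K)

      -- The residue 2 z lies between z and y = 4 z: two applications of `arc-double` lead from the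
      -- arc of z to that of y.
      apart₁₄ : (H : HitAt 1) (K : HitAt 4) → 1 * y H % w ≡ 4 * y K % w → value H ≢ value K
      apart₁₄ H K e =
        let b , b< , f = arc-double (range K) (twice-range (range K)) (twice-% (y K))
            c , c< , g = arc-double (twice-range (range K)) (range H) (1*% {y H} (trans e (sym (twice-twice (y K))))) in
        disjoint-sound _ _ (quadruple-disjoint (arc<A (range K)) b< c<)
          (subst (λ k → value H ∈ keys (arcType k) 1) (trans g (cong (λ k → double k c) f)) (value∈ H)) (value∈ K)

      apart₃ : ∀ {μ} → μ ∈ (1 ∷ 2 ∷ 4 ∷ []) → (H : HitAt 3) (K : HitAt μ) → value H ≢ value K
      apart₃ μ∈ H K = disjoint-sound _ _ (triple-disjoint (typeAt∈ (range H)) (typeAt∈ (range K)) μ∈) (value∈ H) (value∈ K)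

      Same-hit : ∀ {μ ν} → HitAt μ → HitAt ν → Set
      Same-hit H K = (y H ≡ y K) × (hit H ≡ hit K)

      -- Invertibility of μ makes the positions equal. Then the types agree too, and the keys of a
      -- single type and slope are distinct.
      same-slope : ∀ {μ} → Slope μ → ∀ c → μ * c ≡ 24 → (H K : HitAt μ) → μ * y H % w ≡ μ * y K % w →
                   value H ≡ value K → Same-hit H K
      same-slope {μ} sl c μc H K e v = let yy = cancel μ c μc (proj₂ (range H)) (proj₂ (range K)) e in
        yy , map-injective (hitKey (typeAt (y H))) (hits μ)
                        (distinct⇒Unique _ (distinct-keys (typeAt∈ (range H)) sl)) (∈hits H) (∈hits K)
                        (trans v (cong (λ z → hitKey (typeAt z) (hit K)) (sym yy)))

    hit-injective : ∀ {μ ν} → Slope μ → Slope ν → (H : HitAt μ) (K : HitAt ν) →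
                    μ * y H % w ≡ ν * y K % w → value H ≡ value K → Same-hit H K
    hit-injective one   one   H K e v = same-slope one 24 refl H K e v
    hit-injective two   two   H K e v = same-slope two 12 refl H K e v
    hit-injective three three H K e v = same-slope three 8 refl H K e v
    hit-injective four  four  H K e v = same-slope four 6 refl H K e v
    hit-injective one   two   H K e v = ⊥-elim (apart₁₂ H K e v)
    hit-injective two   one   H K e v = ⊥-elim (apart₁₂ K H (sym e) (sym v))
    hit-injective two   four  H K e v = ⊥-elim (apart₂₄ H K e v)
    hit-injective four  two   H K e v = ⊥-elim (apart₂₄ K H (sym e) (sym v))
    hit-injective one   four  H K e v = ⊥-elim (apart₁₄ H K e v)
    hit-injective four  one   H K e v = ⊥-elim (apart₁₄ K H (sym e) (sym v))
    hit-injective three one   H K e v = ⊥-elim (apart₃ (here refl) H K v)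
    hit-injective three two   H K e v = ⊥-elim (apart₃ (there (here refl)) H K v)
    hit-injective three four  H K e v = ⊥-elim (apart₃ (there (there (here refl))) H K v)
    hit-injective one   three H K e v = ⊥-elim (apart₃ (here refl) K H (sym v))
    hit-injective two   three H K e v = ⊥-elim (apart₃ (there (here refl)) K H (sym v))
    hit-injective four  three H K e v = ⊥-elim (apart₃ (there (there (here refl))) K H (sym v))

    position : Fin r → ℕ
    position j = suc (toℕ j)

    position-range : ∀ j → InRange (position j)
    position-range j = z<s , s≤s (ℕ.≤-trans (toℕ<n j) (ℕ.m≤m+n r (r ℕ.+ 0)))

    position-≤ : ∀ j → position j ≤ r
    position-≤ = toℕ<n

    step : Fin 5 → ℕ → ℤ
    step s y = + (toℕ s * y)

    -- Every difference of a block is the multiple μ y of some y in range: y is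
    -- the position of the block or its negative, according to the order of the
    -- two rows.
    record Oriented (j : Fin r) (i : ℕ) (a : Slot) : Set where
      field
        {μ}   : ℕ
        slp   : Slope μ
        at-μ  : HitAt μ
        index : proj₁ (hit at-μ) ≡ i
        same  : value at-μ ≡ key (typeAt (position j)) i a
        cong-w : Cg w (+ (μ * y at-μ)) (step (proj₁ (proj₂ a)) (position j) ℤ.- step (proj₂ (proj₂ a)) (position j))
        order : (y at-μ ≡ position j × proj₂ (hit at-μ) ≡ a) ⊎
                (y at-μ ≡ w ℕ.∸ position j × proj₂ (hit at-μ) ≡ (proj₁ a , proj₂ (proj₂ a) , proj₁ (proj₂ a)))

    private
      arcs-opposite : ∀ {y} → InRange y → typeAt (w ℕ.∸ y) ≡ opposite (typeAt y)
      arcs-opposite ry = trans (cong arcType (arc-neg ry)) (arcType-opposite (arc<A ry))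

      split-* : ∀ s t y → t ≤ s → + ((s ℕ.∸ t) * y) ≡ + (s * y) ℤ.- + (t * y)
      split-* s t y t≤s = begin
        + ((s ℕ.∸ t) * y)                                  ≡⟨ lem (+ ((s ℕ.∸ t) * y)) (+ (t * y)) ⟩
        (+ ((s ℕ.∸ t) * y) ℤ.+ + (t * y)) ℤ.- + (t * y)    ≡⟨ cong (λ z → + z ℤ.- + (t * y))
                                                               (trans (sym (ℕ.*-distribʳ-+ y (s ℕ.∸ t) t)) (cong (_* y) (ℕ.m∸n+n≡m t≤s))) ⟩
        + (s * y) ℤ.- + (t * y)                            ∎
        where
        open ≡-Reasoning
        lem : ∀ a b → a ≡ (a ℤ.+ b) ℤ.- b
        lem = solve-∀

    private
      hitAt : ∀ z → InRange z → ∀ i κ s u → i < q₀ → Valid (κ , s , u) → toℕ u < toℕ s → HitAt (toℕ s ℕ.∸ toℕ u)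
      hitAt z rz i κ s u i< v u<s = record
        { y = z ; range = rz ; hit = i , κ , s , u
        ; ∈hits = ∈-hits {toℕ s ℕ.∸ toℕ u} {i} κ s u i< v (sym (ℕ.m∸n+n≡m (ℕ.<⇒≤ u<s))) }

      neg-range : ∀ j → InRange (w ℕ.∸ position j)
      neg-range j = let p<w = proj₂ (position-range j) in
        ℕ.m<n⇒0<n∸m p<w , ℕ.∸-monoʳ-< {w} {position j} {0} z<s (ℕ.<⇒≤ p<w)

      neg-step : ∀ p s u → p ≤ w → toℕ s < toℕ u →
        Cg w (+ ((toℕ u ℕ.∸ toℕ s) * (w ℕ.∸ p))) (step s p ℤ.- step u p)
      -- The quotient comes from d (w - p) = d w - d p.
      neg-step p s u p≤w s<u = + d , (begin
        + (d * (w ℕ.∸ p))                                   ≡⟨ lem₁ (+ (d * (w ℕ.∸ p))) (+ (d * p)) ⟩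
        (+ (d * (w ℕ.∸ p)) ℤ.+ + (d * p)) ℤ.- + (d * p)     ≡⟨ cong₂ ℤ._-_ (trans (cong +_ whole) (ℤ.pos-* d w)) (split-* (toℕ u) (toℕ s) p (ℕ.<⇒≤ s<u)) ⟩
        + d ℤ.* + w ℤ.- (step u p ℤ.- step s p)             ≡⟨ lem₂ (+ d ℤ.* + w) (step u p) (step s p) ⟩
        (step s p ℤ.- step u p) ℤ.+ + d ℤ.* + w             ∎)
        where
        open ≡-Reasoning
        d : ℕ
        d = toℕ u ℕ.∸ toℕ s
        whole : d * (w ℕ.∸ p) ℕ.+ d * p ≡ d * w
        whole = trans (sym (ℕ.*-distribˡ-+ d (w ℕ.∸ p) p)) (cong (d *_) (ℕ.m∸n+n≡m p≤w))
        lem₁ : ∀ a b → a ≡ (a ℤ.+ b) ℤ.- b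
        lem₁ = solve-∀
        lem₂ : ∀ a b c → a ℤ.- (b ℤ.- c) ≡ (c ℤ.- b) ℤ.+ a
        lem₂ = solve-∀

      -- Passing to w - y changes the sign of the type, and the exchange of the rows undoes this.
      key-neg : ∀ j i κ s u → key (typeAt (w ℕ.∸ position j)) i (κ , u , s) ≡ key (typeAt (position j)) i (κ , s , u)
      key-neg j i κ s u = trans (cong (λ τ → key τ i (κ , u , s)) (arcs-opposite (position-range j)))
                                (key-opposite (typeAt (position j)) i κ u s)

      descending : ∀ j i κ s u → i < q₀ → Valid (κ , s , u) → toℕ u < toℕ s → Oriented j i (κ , s , u)
      descending j i κ s u i< v u<s = record
        { μ     = toℕ s ℕ.∸ toℕ u
        ; slp   = slope s u u<s
        ; at-μ  = hitAt (position j) (position-range j) i κ s u i< v u<s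
        ; index = refl
        ; same  = refl
        ; cong-w = cg-reflexive (split-* (toℕ s) (toℕ u) (position j) (ℕ.<⇒≤ u<s))
        ; order = inj₁ (refl , refl)
        }

      ascending : ∀ j i κ s u → i < q₀ → Valid (κ , s , u) → toℕ s < toℕ u → Oriented j i (κ , s , u)
      ascending j i κ s u i< v s<u = record
        { μ     = toℕ u ℕ.∸ toℕ s
        ; slp   = slope u s s<u
        ; at-μ  = hitAt (w ℕ.∸ position j) (neg-range j) i κ u s i< (valid-sym κ s u v) s<u
        ; index = refl
        ; same  = key-neg j i κ s u
        ; cong-w = neg-step (position j) s u (ℕ.<⇒≤ (proj₂ (position-range j))) s<u
        ; order = inj₂ (refl , refl)
        }

    oriented : ∀ j i → i < q₀ → ∀ a → Valid a → Oriented j i a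
    oriented j i i< (κ , s , u) v = Sum.[ descending j i κ s u i< v , ascending j i κ s u i< v ]′ (rows-apart κ s u v)

    private
      -- Two positions add up to at most 2 r, which is less than w.
      positions-apart : ∀ j j′ → position j ≢ w ℕ.∸ position j′
      positions-apart j j′ e = ℕ.<-irrefl refl (ℕ.≤-trans (ℕ.≤-reflexive (sym total)) (ℕ.+-mono-≤ (position-≤ j) (ℕ.≤-trans (position-≤ j′) (ℕ.≤-reflexive (sym (ℕ.+-identityʳ r))))))
        where
        total : position j ℕ.+ position j′ ≡ w
        total = trans (cong (ℕ._+ position j′) e) (ℕ.m∸n+n≡m (ℕ.<⇒≤ (proj₂ (position-range j′))))

      position-injective : ∀ {j j′} → position j ≡ position j′ → j ≡ j′
      position-injective e = toℕ-injective (ℕ.suc-injective e)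

      swap-injective : ∀ {κ κ′ : Kind} {s t s′ t′ : Fin 5} → _≡_ {A = Slot} (κ , s , t) (κ′ , s′ , t′) → _≡_ {A = Slot} (κ , t , s) (κ′ , t′ , s′)
      swap-injective refl = refl

    -- Both differences are brought to normal form, and `hit-injective` identifies their residues
    -- and hits. By `positions-apart` the two orientations agree, so position, index and slot can be
    -- read back.
    injective : ∀ j j′ i i′ a a′ → i < q₀ → i′ < q₀ → Valid a → Valid a′ →
      key (typeAt (position j)) i a ≡ key (typeAt (position j′)) i′ a′ →
      Cg w (step (proj₁ (proj₂ a)) (position j) ℤ.- step (proj₂ (proj₂ a)) (position j))
           (step (proj₁ (proj₂ a′)) (position j′) ℤ.- step (proj₂ (proj₂ a′)) (position j′)) →
      j ≡ j′ × i ≡ i′ × a ≡ a′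
    injective j j′ i i′ a a′ i< i′< v v′ ek ec =
      conclude (Oriented.order O) (Oriented.order O′) , trans (sym (Oriented.index O)) (trans (cong proj₁ hh) (Oriented.index O′)) ,
      conclude′ (Oriented.order O) (Oriented.order O′)
      where
      O : Oriented j i a
      O = oriented j i i< a v
      O′ : Oriented j′ i′ a′
      O′ = oriented j′ i′ i′< a′ v′
      both : (y (Oriented.at-μ O) ≡ y (Oriented.at-μ O′)) × (hit (Oriented.at-μ O) ≡ hit (Oriented.at-μ O′))
      both = hit-injective (Oriented.slp O) (Oriented.slp O′) (Oriented.at-μ O) (Oriented.at-μ O′)
        (cg-%ℕ w _ _ (cg-trans (Oriented.cong-w O) (cg-trans ec (cg-sym (Oriented.cong-w O′)))))
        (trans (Oriented.same O) (trans ek (sym (Oriented.same O′))))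
      yy : y (Oriented.at-μ O) ≡ y (Oriented.at-μ O′)
      yy = proj₁ both
      hh : hit (Oriented.at-μ O) ≡ hit (Oriented.at-μ O′)
      hh = proj₂ both
      Order : Fin r → Slot → ℕ → Slot → Set
      Order j a z b = (z ≡ position j × b ≡ a) ⊎ (z ≡ w ℕ.∸ position j × b ≡ (proj₁ a , proj₂ (proj₂ a) , proj₁ (proj₂ a)))
      conclude : Order j a (y (Oriented.at-μ O)) (proj₂ (hit (Oriented.at-μ O))) →
                 Order j′ a′ (y (Oriented.at-μ O′)) (proj₂ (hit (Oriented.at-μ O′))) → j ≡ j′
      conclude (inj₁ (e , _)) (inj₁ (e′ , _)) = position-injective (trans (sym e) (trans yy e′))
      conclude (inj₁ (e , _)) (inj₂ (e′ , _)) = ⊥-elim (positions-apart j j′ (trans (sym e) (trans yy e′)))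
      conclude (inj₂ (e , _)) (inj₁ (e′ , _)) = ⊥-elim (positions-apart j′ j (trans (sym e′) (trans (sym yy) e)))
      conclude (inj₂ (e , _)) (inj₂ (e′ , _)) = position-injective
        (ℕ.∸-cancelˡ-≡ (ℕ.<⇒≤ (proj₂ (position-range j))) (ℕ.<⇒≤ (proj₂ (position-range j′))) (trans (sym e) (trans yy e′)))
      conclude′ : Order j a (y (Oriented.at-μ O)) (proj₂ (hit (Oriented.at-μ O))) →
                  Order j′ a′ (y (Oriented.at-μ O′)) (proj₂ (hit (Oriented.at-μ O′))) → a ≡ a′
      conclude′ (inj₁ (_ , f)) (inj₁ (_ , f′)) = trans (sym f) (trans (cong proj₂ hh) f′)
      conclude′ (inj₁ (e , _)) (inj₂ (e′ , _)) = ⊥-elim (positions-apart j j′ (trans (sym e) (trans yy e′)))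
      conclude′ (inj₂ (e , _)) (inj₁ (e′ , _)) = ⊥-elim (positions-apart j′ j (trans (sym e′) (trans (sym yy) e)))
      conclude′ (inj₂ (_ , f)) (inj₂ (_ , f′)) = swap-injective (trans (sym f) (trans (cong proj₂ hh) f′))

    nonzero : ∀ j i a → i < q₀ → Valid a →
      ¬ Cg w (step (proj₁ (proj₂ a)) (position j) ℤ.- step (proj₂ (proj₂ a)) (position j)) 0ℤ
    nonzero j i a i< v ec = lemma (Oriented.slp O) (range (Oriented.at-μ O))
      (cg-%ℕ w _ 0 (cg-trans (Oriented.cong-w O) ec))
      where
      O : Oriented j i a
      O = oriented j i i< a v
      contra : ∀ μ c → μ * c ≡ 24 → ∀ {z} → InRange z → μ * z % w ≡ 0 % w → ⊥
      contra μ c e {suc z} rz f = ℕ.<⇒≱ (proj₂ rz) (∣⇒≤ (cancel-∣ μ c e (m%n≡0⇒n∣m (μ * suc z) w f)))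
      lemma : ∀ {μ z} → Slope μ → InRange z → μ * z % w ≡ 0 % w → ⊥
      lemma one   = contra 1 24 refl
      lemma two   = contra 2 12 refl
      lemma three = contra 3 8 refl
      lemma four  = contra 4 6 refl

    fam : Fam m n q w 1
    fam = record
      { Ix = Fin r × Fin q₀
      ; ixs = cartesianProduct (allFin r) (allFin q₀)
      ; unique = Unique.cartesianProduct⁺ (Unique.allFin⁺ r) (Unique.allFin⁺ q₀)
      ; size = size
      ; g = λ (j , i) → typed (typeAt (position j)) (toℕ i)
      ; h = λ (j , i) κ s → step s (position j) , 0ℤ
      ; inj = λ (j , i) (j′ , i′) a a′ v v′ eg (eh , _) → index-≡
          (injective j j′ (toℕ i) (toℕ i′) a a′ (toℕ<n i) (toℕ<n i′) v v′
            (key-cong (typeAt (position j)) (typeAt (position j′)) (toℕ i) (toℕ i′) a a′ eg) eh)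
      ; off = λ (j , i) a v (e , _) → nonzero j (toℕ i) a (toℕ<n i) v e
      }
      where
      size : q ℕ.+ length (cartesianProduct (allFin r) (allFin q₀)) ≡ q * (w * 1)
      size = trans (cong (q ℕ.+_) (trans (length-cartesianProduct (allFin r) (allFin q₀))
               (cong₂ _*_ (length-tabulate (λ (i : Fin r) → i)) (trans (length-tabulate (λ (i : Fin q₀) → i)) q₀≡2q)))) (lem q r)
        where
        lem : ∀ q r → q ℕ.+ r * (2 * q) ≡ q * (suc (2 * r) * 1)
        lem = ℕSolver.solve-∀

-- Tables

-- The point (a , b) is coded 8 a + b. Over each nonzero residue modulo w the slopes 1 to 4
-- contribute 14, 10, 6 and 2 differences, 32 in all, so that every element of Z_4 × Z_8 is used
-- there.
blocks₄ₓ₈ : List (List (List ℕ))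
blocks₄ₓ₈ =
  ((0 ∷ 26 ∷ 31 ∷ 2 ∷ 12 ∷ 0 ∷ 7 ∷ 23 ∷ 0 ∷ []) ∷
   (0 ∷ 30 ∷ 3 ∷ 22 ∷ 28 ∷ 0 ∷ 15 ∷ 27 ∷ 4 ∷ []) ∷
   []) ∷
  ((0 ∷ 26 ∷ 3 ∷ 2 ∷ 12 ∷ 0 ∷ 5 ∷ 17 ∷ 4 ∷ []) ∷
   (0 ∷ 30 ∷ 15 ∷ 22 ∷ 28 ∷ 0 ∷ 13 ∷ 29 ∷ 0 ∷ []) ∷
   []) ∷
  ((0 ∷ 26 ∷ 5 ∷ 2 ∷ 12 ∷ 0 ∷ 23 ∷ 7 ∷ 0 ∷ []) ∷
   (0 ∷ 30 ∷ 9 ∷ 22 ∷ 28 ∷ 0 ∷ 31 ∷ 11 ∷ 4 ∷ []) ∷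
   []) ∷
  []

-- Each type has six rows, since a row accounts for 16 differences over each nonzero residue and
-- Z_12 × Z_8 has 96 = 6 · 16 elements.
blocks₁₂ₓ₈ : List (List (List ℕ))
blocks₁₂ₓ₈ =
  ((0 ∷ 6 ∷ 15 ∷ 44 ∷ 84 ∷ 0 ∷ 89 ∷ 59 ∷ 92 ∷ []) ∷
   (0 ∷ 2 ∷ 41 ∷ 60 ∷ 20 ∷ 0 ∷ 63 ∷ 93 ∷ 12 ∷ []) ∷
   (0 ∷ 8 ∷ 79 ∷ 30 ∷ 76 ∷ 0 ∷ 31 ∷ 7 ∷ 34 ∷ []) ∷
   (0 ∷ 88 ∷ 73 ∷ 74 ∷ 28 ∷ 0 ∷ 25 ∷ 49 ∷ 70 ∷ []) ∷
   (0 ∷ 16 ∷ 85 ∷ 10 ∷ 42 ∷ 0 ∷ 17 ∷ 65 ∷ 0 ∷ []) ∷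
   (0 ∷ 80 ∷ 67 ∷ 94 ∷ 62 ∷ 0 ∷ 95 ∷ 43 ∷ 4 ∷ []) ∷
   []) ∷
  ((0 ∷ 6 ∷ 31 ∷ 44 ∷ 84 ∷ 0 ∷ 83 ∷ 53 ∷ 92 ∷ []) ∷
   (0 ∷ 2 ∷ 25 ∷ 60 ∷ 20 ∷ 0 ∷ 69 ∷ 3 ∷ 12 ∷ []) ∷
   (0 ∷ 8 ∷ 63 ∷ 30 ∷ 76 ∷ 0 ∷ 29 ∷ 5 ∷ 34 ∷ []) ∷
   (0 ∷ 88 ∷ 89 ∷ 74 ∷ 28 ∷ 0 ∷ 27 ∷ 51 ∷ 70 ∷ []) ∷
   (0 ∷ 16 ∷ 73 ∷ 10 ∷ 42 ∷ 0 ∷ 63 ∷ 15 ∷ 0 ∷ []) ∷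
   (0 ∷ 80 ∷ 79 ∷ 94 ∷ 62 ∷ 0 ∷ 17 ∷ 69 ∷ 4 ∷ []) ∷
   []) ∷
  ((0 ∷ 6 ∷ 63 ∷ 44 ∷ 84 ∷ 0 ∷ 55 ∷ 17 ∷ 92 ∷ []) ∷
   (0 ∷ 2 ∷ 89 ∷ 60 ∷ 20 ∷ 0 ∷ 1 ∷ 39 ∷ 12 ∷ []) ∷
   (0 ∷ 8 ∷ 31 ∷ 30 ∷ 76 ∷ 0 ∷ 29 ∷ 5 ∷ 34 ∷ []) ∷
   (0 ∷ 88 ∷ 25 ∷ 74 ∷ 28 ∷ 0 ∷ 27 ∷ 51 ∷ 70 ∷ []) ∷
   (0 ∷ 16 ∷ 55 ∷ 10 ∷ 42 ∷ 0 ∷ 45 ∷ 93 ∷ 0 ∷ []) ∷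
   (0 ∷ 80 ∷ 1 ∷ 94 ∷ 62 ∷ 0 ∷ 81 ∷ 37 ∷ 4 ∷ []) ∷
   []) ∷
  []

blocks₄ₓ₂₄ : List (List (List ℕ))
blocks₄ₓ₂₄ =
  ((0 ∷ 6 ∷ 31 ∷ 44 ∷ 52 ∷ 0 ∷ 89 ∷ 91 ∷ 92 ∷ []) ∷
   (0 ∷ 18 ∷ 41 ∷ 76 ∷ 68 ∷ 0 ∷ 79 ∷ 77 ∷ 28 ∷ []) ∷
   (0 ∷ 40 ∷ 39 ∷ 78 ∷ 36 ∷ 0 ∷ 87 ∷ 15 ∷ 10 ∷ []) ∷
   (0 ∷ 80 ∷ 33 ∷ 42 ∷ 84 ∷ 0 ∷ 81 ∷ 57 ∷ 14 ∷ []) ∷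
   (0 ∷ 56 ∷ 61 ∷ 34 ∷ 26 ∷ 0 ∷ 65 ∷ 17 ∷ 0 ∷ []) ∷
   (0 ∷ 64 ∷ 11 ∷ 86 ∷ 94 ∷ 0 ∷ 95 ∷ 35 ∷ 12 ∷ []) ∷
   []) ∷
  ((0 ∷ 6 ∷ 87 ∷ 44 ∷ 52 ∷ 0 ∷ 67 ∷ 69 ∷ 92 ∷ []) ∷
   (0 ∷ 18 ∷ 81 ∷ 76 ∷ 68 ∷ 0 ∷ 5 ∷ 3 ∷ 28 ∷ []) ∷
   (0 ∷ 40 ∷ 79 ∷ 78 ∷ 36 ∷ 0 ∷ 93 ∷ 21 ∷ 10 ∷ []) ∷
   (0 ∷ 80 ∷ 89 ∷ 42 ∷ 84 ∷ 0 ∷ 75 ∷ 51 ∷ 14 ∷ []) ∷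
   (0 ∷ 56 ∷ 33 ∷ 34 ∷ 26 ∷ 0 ∷ 79 ∷ 31 ∷ 0 ∷ []) ∷
   (0 ∷ 64 ∷ 39 ∷ 86 ∷ 94 ∷ 0 ∷ 65 ∷ 5 ∷ 12 ∷ []) ∷
   []) ∷
  ((0 ∷ 6 ∷ 79 ∷ 44 ∷ 52 ∷ 0 ∷ 63 ∷ 65 ∷ 92 ∷ []) ∷
   (0 ∷ 18 ∷ 89 ∷ 76 ∷ 68 ∷ 0 ∷ 9 ∷ 7 ∷ 28 ∷ []) ∷
   (0 ∷ 40 ∷ 87 ∷ 78 ∷ 36 ∷ 0 ∷ 93 ∷ 21 ∷ 10 ∷ []) ∷
   (0 ∷ 80 ∷ 81 ∷ 42 ∷ 84 ∷ 0 ∷ 75 ∷ 51 ∷ 14 ∷ []) ∷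
   (0 ∷ 56 ∷ 63 ∷ 34 ∷ 26 ∷ 0 ∷ 29 ∷ 77 ∷ 0 ∷ []) ∷
   (0 ∷ 64 ∷ 9 ∷ 86 ∷ 94 ∷ 0 ∷ 49 ∷ 13 ∷ 12 ∷ []) ∷
   []) ∷
  []

-- Two pairs are what 32 (c + 1) = 96 requires.
packing₁₂ₓ₈ : List (List ℕ)
packing₁₂ₓ₈ =
  (6 ∷ 74 ∷ 75 ∷ 49 ∷ 88 ∷ 82 ∷ 90 ∷ 41 ∷ 52 ∷ []) ∷
  (55 ∷ 16 ∷ 60 ∷ 1 ∷ 31 ∷ 17 ∷ 86 ∷ 23 ∷ 46 ∷ []) ∷
  []

packing₄ₓ₂₄ : List (List ℕ)
packing₄ₓ₂₄ =
  (6 ∷ 42 ∷ 27 ∷ 57 ∷ 80 ∷ 58 ∷ 74 ∷ 41 ∷ 60 ∷ []) ∷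
  (63 ∷ 56 ∷ 76 ∷ 9 ∷ 87 ∷ 65 ∷ 70 ∷ 71 ∷ 38 ∷ []) ∷
  []

-- Scalar multiples fail here, as five scalars cannot be pairwise incongruent modulo 3. The matrix
-- is normalised: its first row is zero, its second is the identity, and the others are odd
-- functions on Z_27.
matrix₂₇ : List (List ℕ)
matrix₂₇ =
  (0 ∷ 0 ∷ 0 ∷ 0 ∷ 0 ∷ []) ∷
  (0 ∷ 1 ∷ 20 ∷ 6 ∷ 5 ∷ []) ∷
  (0 ∷ 2 ∷ 19 ∷ 20 ∷ 16 ∷ []) ∷
  (0 ∷ 3 ∷ 4 ∷ 13 ∷ 21 ∷ []) ∷
  (0 ∷ 4 ∷ 24 ∷ 19 ∷ 1 ∷ []) ∷
  (0 ∷ 5 ∷ 16 ∷ 4 ∷ 7 ∷ []) ∷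
  (0 ∷ 6 ∷ 21 ∷ 2 ∷ 13 ∷ []) ∷
  (0 ∷ 7 ∷ 12 ∷ 1 ∷ 18 ∷ []) ∷
  (0 ∷ 8 ∷ 10 ∷ 16 ∷ 23 ∷ []) ∷
  (0 ∷ 9 ∷ 5 ∷ 22 ∷ 10 ∷ []) ∷
  (0 ∷ 10 ∷ 13 ∷ 17 ∷ 15 ∷ []) ∷
  (0 ∷ 11 ∷ 2 ∷ 9 ∷ 3 ∷ []) ∷
  (0 ∷ 12 ∷ 18 ∷ 15 ∷ 2 ∷ []) ∷
  (0 ∷ 13 ∷ 26 ∷ 24 ∷ 19 ∷ []) ∷
  (0 ∷ 14 ∷ 1 ∷ 3 ∷ 8 ∷ []) ∷
  (0 ∷ 15 ∷ 9 ∷ 12 ∷ 25 ∷ []) ∷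
  (0 ∷ 16 ∷ 25 ∷ 18 ∷ 24 ∷ []) ∷
  (0 ∷ 17 ∷ 14 ∷ 10 ∷ 12 ∷ []) ∷
  (0 ∷ 18 ∷ 22 ∷ 5 ∷ 17 ∷ []) ∷
  (0 ∷ 19 ∷ 17 ∷ 11 ∷ 4 ∷ []) ∷
  (0 ∷ 20 ∷ 15 ∷ 26 ∷ 9 ∷ []) ∷
  (0 ∷ 21 ∷ 6 ∷ 25 ∷ 14 ∷ []) ∷
  (0 ∷ 22 ∷ 11 ∷ 23 ∷ 20 ∷ []) ∷
  (0 ∷ 23 ∷ 3 ∷ 8 ∷ 26 ∷ []) ∷
  (0 ∷ 24 ∷ 23 ∷ 14 ∷ 6 ∷ []) ∷
  (0 ∷ 25 ∷ 8 ∷ 7 ∷ 11 ∷ []) ∷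
  (0 ∷ 26 ∷ 7 ∷ 21 ∷ 22 ∷ []) ∷
  []

-- Part of the multiplication table of F₉ = F₃(i) with i² = -1, where x i + y is coded 3 x + y. The
-- rows are the multiples by 0, 1, 2, 2 i and 2 i + 1, whose differences are invertible.
matrix₃ₓ₃ : List (List ℕ)
matrix₃ₓ₃ =
  (0 ∷ 0 ∷ 0 ∷ 0 ∷ 0 ∷ []) ∷
  (0 ∷ 1 ∷ 2 ∷ 6 ∷ 7 ∷ []) ∷
  (0 ∷ 2 ∷ 1 ∷ 3 ∷ 5 ∷ []) ∷
  (0 ∷ 3 ∷ 6 ∷ 1 ∷ 4 ∷ []) ∷
  (0 ∷ 4 ∷ 8 ∷ 7 ∷ 2 ∷ []) ∷
  (0 ∷ 5 ∷ 7 ∷ 4 ∷ 6 ∷ []) ∷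
  (0 ∷ 6 ∷ 3 ∷ 2 ∷ 8 ∷ []) ∷
  (0 ∷ 7 ∷ 5 ∷ 8 ∷ 3 ∷ []) ∷
  (0 ∷ 8 ∷ 4 ∷ 5 ∷ 1 ∷ []) ∷
  []

rows₉ : List (List ℕ)
rows₉ =
  (155 ∷ 107 ∷ 132 ∷ 22 ∷ 124 ∷ 0 ∷ 151 ∷ 212 ∷ 65 ∷ []) ∷
  (267 ∷ 19 ∷ 77 ∷ 236 ∷ 192 ∷ 0 ∷ 181 ∷ 24 ∷ 202 ∷ []) ∷
  (56 ∷ 121 ∷ 190 ∷ 71 ∷ 43 ∷ 0 ∷ 148 ∷ 113 ∷ 224 ∷ []) ∷
  (119 ∷ 239 ∷ 244 ∷ 45 ∷ 223 ∷ 0 ∷ 2 ∷ 264 ∷ 233 ∷ []) ∷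
  (160 ∷ 136 ∷ 93 ∷ 23 ∷ 83 ∷ 0 ∷ 5 ∷ 285 ∷ 251 ∷ []) ∷
  (228 ∷ 26 ∷ 112 ∷ 277 ∷ 195 ∷ 0 ∷ 8 ∷ 268 ∷ 226 ∷ []) ∷
  (61 ∷ 86 ∷ 197 ∷ 64 ∷ 38 ∷ 0 ∷ 145 ∷ 133 ∷ 237 ∷ []) ∷
  (88 ∷ 274 ∷ 287 ∷ 45 ∷ 254 ∷ 0 ∷ 6 ∷ 278 ∷ 241 ∷ []) ∷
  []

rows₂₇ : List (List ℕ)
rows₂₇ =
  (96 ∷ 664 ∷ 174 ∷ 53 ∷ 554 ∷ 0 ∷ 440 ∷ 645 ∷ 200 ∷ []) ∷
  (649 ∷ 607 ∷ 7 ∷ 592 ∷ 683 ∷ 0 ∷ 112 ∷ 484 ∷ 573 ∷ []) ∷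
  (330 ∷ 741 ∷ 700 ∷ 704 ∷ 499 ∷ 0 ∷ 543 ∷ 104 ∷ 628 ∷ []) ∷
  (623 ∷ 838 ∷ 670 ∷ 825 ∷ 254 ∷ 0 ∷ 117 ∷ 52 ∷ 146 ∷ []) ∷
  (685 ∷ 813 ∷ 653 ∷ 512 ∷ 427 ∷ 0 ∷ 129 ∷ 99 ∷ 192 ∷ []) ∷
  (403 ∷ 529 ∷ 759 ∷ 785 ∷ 465 ∷ 0 ∷ 23 ∷ 639 ∷ 626 ∷ []) ∷
  (154 ∷ 350 ∷ 456 ∷ 827 ∷ 315 ∷ 0 ∷ 1 ∷ 636 ∷ 634 ∷ []) ∷
  (793 ∷ 734 ∷ 2 ∷ 489 ∷ 582 ∷ 0 ∷ 9 ∷ 775 ∷ 665 ∷ []) ∷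
  (90 ∷ 7 ∷ 177 ∷ 159 ∷ 236 ∷ 0 ∷ 441 ∷ 336 ∷ 672 ∷ []) ∷
  (396 ∷ 492 ∷ 333 ∷ 568 ∷ 193 ∷ 0 ∷ 444 ∷ 344 ∷ 667 ∷ []) ∷
  (581 ∷ 394 ∷ 501 ∷ 211 ∷ 334 ∷ 0 ∷ 436 ∷ 337 ∷ 666 ∷ []) ∷
  (406 ∷ 175 ∷ 720 ∷ 10 ∷ 353 ∷ 0 ∷ 442 ∷ 331 ∷ 651 ∷ []) ∷
  (593 ∷ 96 ∷ 233 ∷ 23 ∷ 291 ∷ 0 ∷ 457 ∷ 340 ∷ 657 ∷ []) ∷
  (93 ∷ 767 ∷ 177 ∷ 28 ∷ 553 ∷ 0 ∷ 448 ∷ 355 ∷ 687 ∷ []) ∷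
  (782 ∷ 608 ∷ 20 ∷ 569 ∷ 802 ∷ 0 ∷ 11 ∷ 851 ∷ 753 ∷ []) ∷
  (237 ∷ 852 ∷ 785 ∷ 835 ∷ 500 ∷ 0 ∷ 439 ∷ 367 ∷ 693 ∷ []) ∷
  (646 ∷ 755 ∷ 761 ∷ 714 ∷ 367 ∷ 0 ∷ 15 ∷ 847 ∷ 734 ∷ []) ∷
  (800 ∷ 726 ∷ 778 ∷ 487 ∷ 302 ∷ 0 ∷ 22 ∷ 858 ∷ 730 ∷ []) ∷
  (272 ∷ 524 ∷ 672 ∷ 700 ∷ 480 ∷ 0 ∷ 456 ∷ 422 ∷ 736 ∷ []) ∷
  (143 ∷ 217 ∷ 435 ∷ 712 ∷ 414 ∷ 0 ∷ 438 ∷ 399 ∷ 714 ∷ []) ∷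
  (692 ∷ 859 ∷ 25 ∷ 510 ∷ 579 ∷ 0 ∷ 19 ∷ 818 ∷ 713 ∷ []) ∷
  (99 ∷ 20 ∷ 174 ∷ 138 ∷ 331 ∷ 0 ∷ 24 ∷ 835 ∷ 728 ∷ []) ∷
  (279 ∷ 507 ∷ 234 ∷ 593 ∷ 212 ∷ 0 ∷ 437 ∷ 387 ∷ 725 ∷ []) ∷
  (580 ∷ 281 ∷ 498 ∷ 194 ∷ 233 ∷ 0 ∷ 10 ∷ 823 ∷ 726 ∷ []) ∷
  (323 ∷ 176 ∷ 819 ∷ 17 ∷ 268 ∷ 0 ∷ 433 ∷ 389 ∷ 719 ∷ []) ∷
  (568 ∷ 93 ∷ 334 ∷ 4 ∷ 384 ∷ 0 ∷ 21 ∷ 608 ∷ 601 ∷ []) ∷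
  []

rows₃ₓ₃ : List (List ℕ)
rows₃ₓ₃ =
  (15 ∷ 176 ∷ 146 ∷ 130 ∷ 89 ∷ 0 ∷ 1 ∷ 71 ∷ 68 ∷ []) ∷
  (38 ∷ 115 ∷ 27 ∷ 141 ∷ 242 ∷ 0 ∷ 181 ∷ 178 ∷ 66 ∷ []) ∷
  (16 ∷ 32 ∷ 76 ∷ 226 ∷ 168 ∷ 0 ∷ 41 ∷ 20 ∷ 57 ∷ []) ∷
  (215 ∷ 163 ∷ 102 ∷ 50 ∷ 276 ∷ 0 ∷ 145 ∷ 62 ∷ 203 ∷ []) ∷
  (12 ∷ 178 ∷ 145 ∷ 98 ∷ 121 ∷ 0 ∷ 8 ∷ 253 ∷ 223 ∷ []) ∷
  (37 ∷ 77 ∷ 27 ∷ 102 ∷ 274 ∷ 0 ∷ 152 ∷ 137 ∷ 249 ∷ []) ∷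
  (14 ∷ 34 ∷ 116 ∷ 263 ∷ 165 ∷ 0 ∷ 5 ∷ 285 ∷ 251 ∷ []) ∷
  (211 ∷ 164 ∷ 141 ∷ 52 ∷ 237 ∷ 0 ∷ 151 ∷ 128 ∷ 242 ∷ []) ∷
  []

rows₉ₓ₃ : List (List ℕ)
rows₉ₓ₃ =
  (647 ∷ 707 ∷ 182 ∷ 678 ∷ 121 ∷ 0 ∷ 545 ∷ 48 ∷ 578 ∷ []) ∷
  (426 ∷ 77 ∷ 214 ∷ 719 ∷ 224 ∷ 0 ∷ 109 ∷ 537 ∷ 625 ∷ []) ∷
  (178 ∷ 429 ∷ 250 ∷ 275 ∷ 19 ∷ 0 ∷ 435 ∷ 643 ∷ 200 ∷ []) ∷
  (195 ∷ 610 ∷ 564 ∷ 226 ∷ 149 ∷ 0 ∷ 23 ∷ 637 ∷ 628 ∷ []) ∷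
  (291 ∷ 366 ∷ 409 ∷ 772 ∷ 467 ∷ 0 ∷ 547 ∷ 107 ∷ 632 ∷ []) ∷
  (461 ∷ 374 ∷ 187 ∷ 444 ∷ 103 ∷ 0 ∷ 437 ∷ 188 ∷ 600 ∷ []) ∷
  (836 ∷ 340 ∷ 212 ∷ 268 ∷ 137 ∷ 0 ∷ 2 ∷ 767 ∷ 666 ∷ []) ∷
  (372 ∷ 8 ∷ 387 ∷ 600 ∷ 308 ∷ 0 ∷ 458 ∷ 349 ∷ 649 ∷ []) ∷
  (329 ∷ 273 ∷ 861 ∷ 256 ∷ 525 ∷ 0 ∷ 443 ∷ 326 ∷ 657 ∷ []) ∷
  (514 ∷ 303 ∷ 337 ∷ 793 ∷ 723 ∷ 0 ∷ 24 ∷ 776 ∷ 655 ∷ []) ∷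
  (103 ∷ 170 ∷ 134 ∷ 337 ∷ 469 ∷ 0 ∷ 434 ∷ 329 ∷ 672 ∷ []) ∷
  (597 ∷ 8 ∷ 244 ∷ 754 ∷ 340 ∷ 0 ∷ 11 ∷ 772 ∷ 670 ∷ []) ∷
  (28 ∷ 107 ∷ 116 ∷ 372 ∷ 77 ∷ 0 ∷ 450 ∷ 421 ∷ 734 ∷ []) ∷
  (625 ∷ 835 ∷ 172 ∷ 807 ∷ 125 ∷ 0 ∷ 454 ∷ 353 ∷ 698 ∷ []) ∷
  (303 ∷ 61 ∷ 194 ∷ 823 ∷ 346 ∷ 0 ∷ 438 ∷ 417 ∷ 750 ∷ []) ∷
  (176 ∷ 300 ∷ 374 ∷ 403 ∷ 11 ∷ 0 ∷ 455 ∷ 411 ∷ 746 ∷ []) ∷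
  (210 ∷ 608 ∷ 543 ∷ 344 ∷ 151 ∷ 0 ∷ 15 ∷ 784 ∷ 692 ∷ []) ∷
  (384 ∷ 255 ∷ 323 ∷ 662 ∷ 481 ∷ 0 ∷ 449 ∷ 359 ∷ 684 ∷ []) ∷
  (460 ∷ 250 ∷ 167 ∷ 447 ∷ 89 ∷ 0 ∷ 4 ∷ 809 ∷ 683 ∷ []) ∷
  (706 ∷ 230 ∷ 196 ∷ 356 ∷ 136 ∷ 0 ∷ 20 ∷ 858 ∷ 755 ∷ []) ∷
  (249 ∷ 22 ∷ 288 ∷ 615 ∷ 424 ∷ 0 ∷ 25 ∷ 825 ∷ 712 ∷ []) ∷
  (241 ∷ 402 ∷ 732 ∷ 368 ∷ 528 ∷ 0 ∷ 14 ∷ 831 ∷ 722 ∷ []) ∷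
  (515 ∷ 426 ∷ 233 ∷ 695 ∷ 816 ∷ 0 ∷ 444 ∷ 385 ∷ 710 ∷ []) ∷
  (89 ∷ 184 ∷ 112 ∷ 233 ∷ 479 ∷ 0 ∷ 13 ∷ 834 ∷ 718 ∷ []) ∷
  (618 ∷ 22 ∷ 353 ∷ 842 ∷ 230 ∷ 0 ∷ 6 ∷ 819 ∷ 726 ∷ []) ∷
  (29 ∷ 85 ∷ 130 ∷ 249 ∷ 61 ∷ 0 ∷ 8 ∷ 826 ∷ 721 ∷ []) ∷
  []

-- Five blocks of each size over (Z_4 × Z_8 / M) × Z_81, where M = {(a , 2 b)},
-- inflated by a difference matrix with five rows over M ≅ Z_4 × Z_4.
rows₈₁ : List (List ℕ)
rows₈₁ =
  (93 ∷ 100 ∷ 25 ∷ 117 ∷ 127 ∷ 103 ∷ 102 ∷ 153 ∷ 36 ∷ []) ∷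
  (93 ∷ 262 ∷ 673 ∷ 603 ∷ 451 ∷ 103 ∷ 264 ∷ 801 ∷ 522 ∷ []) ∷
  (93 ∷ 424 ∷ 511 ∷ 1899 ∷ 1585 ∷ 103 ∷ 426 ∷ 639 ∷ 1818 ∷ []) ∷
  (93 ∷ 586 ∷ 349 ∷ 2547 ∷ 775 ∷ 103 ∷ 588 ∷ 477 ∷ 2466 ∷ []) ∷
  (93 ∷ 748 ∷ 2455 ∷ 2061 ∷ 1423 ∷ 103 ∷ 750 ∷ 2583 ∷ 1980 ∷ []) ∷
  (93 ∷ 910 ∷ 1645 ∷ 765 ∷ 289 ∷ 103 ∷ 912 ∷ 1773 ∷ 684 ∷ []) ∷
  (93 ∷ 1072 ∷ 2293 ∷ 2223 ∷ 613 ∷ 103 ∷ 1074 ∷ 2421 ∷ 2142 ∷ []) ∷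
  (93 ∷ 1234 ∷ 2131 ∷ 1575 ∷ 2071 ∷ 103 ∷ 1236 ∷ 2259 ∷ 1494 ∷ []) ∷
  (93 ∷ 1396 ∷ 1969 ∷ 1089 ∷ 2395 ∷ 103 ∷ 1398 ∷ 2097 ∷ 1008 ∷ []) ∷
  (93 ∷ 1558 ∷ 1159 ∷ 1737 ∷ 1909 ∷ 103 ∷ 1560 ∷ 1287 ∷ 1656 ∷ []) ∷
  (93 ∷ 1720 ∷ 835 ∷ 1251 ∷ 2233 ∷ 103 ∷ 1722 ∷ 963 ∷ 1170 ∷ []) ∷
  (93 ∷ 1882 ∷ 1483 ∷ 2385 ∷ 937 ∷ 103 ∷ 1884 ∷ 1611 ∷ 2304 ∷ []) ∷
  (93 ∷ 2044 ∷ 1321 ∷ 279 ∷ 2557 ∷ 103 ∷ 2046 ∷ 1449 ∷ 198 ∷ []) ∷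
  (93 ∷ 2206 ∷ 997 ∷ 1413 ∷ 1261 ∷ 103 ∷ 2208 ∷ 1125 ∷ 1332 ∷ []) ∷
  (93 ∷ 2368 ∷ 1807 ∷ 441 ∷ 1099 ∷ 103 ∷ 2370 ∷ 1935 ∷ 360 ∷ []) ∷
  (93 ∷ 2530 ∷ 187 ∷ 927 ∷ 1747 ∷ 103 ∷ 2532 ∷ 315 ∷ 846 ∷ []) ∷
  (93 ∷ 153 ∷ 134 ∷ 71 ∷ 101 ∷ 104 ∷ 81 ∷ 106 ∷ 93 ∷ []) ∷
  (93 ∷ 315 ∷ 782 ∷ 557 ∷ 425 ∷ 104 ∷ 243 ∷ 754 ∷ 579 ∷ []) ∷
  (93 ∷ 477 ∷ 620 ∷ 1853 ∷ 1559 ∷ 104 ∷ 405 ∷ 592 ∷ 1875 ∷ []) ∷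
  (93 ∷ 639 ∷ 458 ∷ 2501 ∷ 749 ∷ 104 ∷ 567 ∷ 430 ∷ 2523 ∷ []) ∷
  (93 ∷ 801 ∷ 2564 ∷ 2015 ∷ 1397 ∷ 104 ∷ 729 ∷ 2536 ∷ 2037 ∷ []) ∷
  (93 ∷ 963 ∷ 1754 ∷ 719 ∷ 263 ∷ 104 ∷ 891 ∷ 1726 ∷ 741 ∷ []) ∷
  (93 ∷ 1125 ∷ 2402 ∷ 2177 ∷ 587 ∷ 104 ∷ 1053 ∷ 2374 ∷ 2199 ∷ []) ∷
  (93 ∷ 1287 ∷ 2240 ∷ 1529 ∷ 2045 ∷ 104 ∷ 1215 ∷ 2212 ∷ 1551 ∷ []) ∷
  (93 ∷ 1449 ∷ 2078 ∷ 1043 ∷ 2369 ∷ 104 ∷ 1377 ∷ 2050 ∷ 1065 ∷ []) ∷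
  (93 ∷ 1611 ∷ 1268 ∷ 1691 ∷ 1883 ∷ 104 ∷ 1539 ∷ 1240 ∷ 1713 ∷ []) ∷
  (93 ∷ 1773 ∷ 944 ∷ 1205 ∷ 2207 ∷ 104 ∷ 1701 ∷ 916 ∷ 1227 ∷ []) ∷
  (93 ∷ 1935 ∷ 1592 ∷ 2339 ∷ 911 ∷ 104 ∷ 1863 ∷ 1564 ∷ 2361 ∷ []) ∷
  (93 ∷ 2097 ∷ 1430 ∷ 233 ∷ 2531 ∷ 104 ∷ 2025 ∷ 1402 ∷ 255 ∷ []) ∷
  (93 ∷ 2259 ∷ 1106 ∷ 1367 ∷ 1235 ∷ 104 ∷ 2187 ∷ 1078 ∷ 1389 ∷ []) ∷
  (93 ∷ 2421 ∷ 1916 ∷ 395 ∷ 1073 ∷ 104 ∷ 2349 ∷ 1888 ∷ 417 ∷ []) ∷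
  (93 ∷ 2583 ∷ 296 ∷ 881 ∷ 1721 ∷ 104 ∷ 2511 ∷ 268 ∷ 903 ∷ []) ∷
  (139 ∷ 86 ∷ 25 ∷ 30 ∷ 104 ∷ 0 ∷ 100 ∷ 3 ∷ 138 ∷ []) ∷
  (139 ∷ 248 ∷ 673 ∷ 516 ∷ 428 ∷ 0 ∷ 262 ∷ 651 ∷ 624 ∷ []) ∷
  (139 ∷ 410 ∷ 511 ∷ 1812 ∷ 1562 ∷ 0 ∷ 424 ∷ 489 ∷ 1920 ∷ []) ∷
  (139 ∷ 572 ∷ 349 ∷ 2460 ∷ 752 ∷ 0 ∷ 586 ∷ 327 ∷ 2568 ∷ []) ∷
  (139 ∷ 734 ∷ 2455 ∷ 1974 ∷ 1400 ∷ 0 ∷ 748 ∷ 2433 ∷ 2082 ∷ []) ∷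
  (139 ∷ 896 ∷ 1645 ∷ 678 ∷ 266 ∷ 0 ∷ 910 ∷ 1623 ∷ 786 ∷ []) ∷
  (139 ∷ 1058 ∷ 2293 ∷ 2136 ∷ 590 ∷ 0 ∷ 1072 ∷ 2271 ∷ 2244 ∷ []) ∷
  (139 ∷ 1220 ∷ 2131 ∷ 1488 ∷ 2048 ∷ 0 ∷ 1234 ∷ 2109 ∷ 1596 ∷ []) ∷
  (139 ∷ 1382 ∷ 1969 ∷ 1002 ∷ 2372 ∷ 0 ∷ 1396 ∷ 1947 ∷ 1110 ∷ []) ∷
  (139 ∷ 1544 ∷ 1159 ∷ 1650 ∷ 1886 ∷ 0 ∷ 1558 ∷ 1137 ∷ 1758 ∷ []) ∷
  (139 ∷ 1706 ∷ 835 ∷ 1164 ∷ 2210 ∷ 0 ∷ 1720 ∷ 813 ∷ 1272 ∷ []) ∷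
  (139 ∷ 1868 ∷ 1483 ∷ 2298 ∷ 914 ∷ 0 ∷ 1882 ∷ 1461 ∷ 2406 ∷ []) ∷
  (139 ∷ 2030 ∷ 1321 ∷ 192 ∷ 2534 ∷ 0 ∷ 2044 ∷ 1299 ∷ 300 ∷ []) ∷
  (139 ∷ 2192 ∷ 997 ∷ 1326 ∷ 1238 ∷ 0 ∷ 2206 ∷ 975 ∷ 1434 ∷ []) ∷
  (139 ∷ 2354 ∷ 1807 ∷ 354 ∷ 1076 ∷ 0 ∷ 2368 ∷ 1785 ∷ 462 ∷ []) ∷
  (139 ∷ 2516 ∷ 187 ∷ 840 ∷ 1724 ∷ 0 ∷ 2530 ∷ 165 ∷ 948 ∷ []) ∷
  (93 ∷ 142 ∷ 15 ∷ 138 ∷ 52 ∷ 91 ∷ 60 ∷ 133 ∷ 107 ∷ []) ∷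
  (93 ∷ 304 ∷ 663 ∷ 624 ∷ 376 ∷ 91 ∷ 222 ∷ 781 ∷ 593 ∷ []) ∷
  (93 ∷ 466 ∷ 501 ∷ 1920 ∷ 1510 ∷ 91 ∷ 384 ∷ 619 ∷ 1889 ∷ []) ∷
  (93 ∷ 628 ∷ 339 ∷ 2568 ∷ 700 ∷ 91 ∷ 546 ∷ 457 ∷ 2537 ∷ []) ∷
  (93 ∷ 790 ∷ 2445 ∷ 2082 ∷ 1348 ∷ 91 ∷ 708 ∷ 2563 ∷ 2051 ∷ []) ∷
  (93 ∷ 952 ∷ 1635 ∷ 786 ∷ 214 ∷ 91 ∷ 870 ∷ 1753 ∷ 755 ∷ []) ∷
  (93 ∷ 1114 ∷ 2283 ∷ 2244 ∷ 538 ∷ 91 ∷ 1032 ∷ 2401 ∷ 2213 ∷ []) ∷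
  (93 ∷ 1276 ∷ 2121 ∷ 1596 ∷ 1996 ∷ 91 ∷ 1194 ∷ 2239 ∷ 1565 ∷ []) ∷
  (93 ∷ 1438 ∷ 1959 ∷ 1110 ∷ 2320 ∷ 91 ∷ 1356 ∷ 2077 ∷ 1079 ∷ []) ∷
  (93 ∷ 1600 ∷ 1149 ∷ 1758 ∷ 1834 ∷ 91 ∷ 1518 ∷ 1267 ∷ 1727 ∷ []) ∷
  (93 ∷ 1762 ∷ 825 ∷ 1272 ∷ 2158 ∷ 91 ∷ 1680 ∷ 943 ∷ 1241 ∷ []) ∷
  (93 ∷ 1924 ∷ 1473 ∷ 2406 ∷ 862 ∷ 91 ∷ 1842 ∷ 1591 ∷ 2375 ∷ []) ∷
  (93 ∷ 2086 ∷ 1311 ∷ 300 ∷ 2482 ∷ 91 ∷ 2004 ∷ 1429 ∷ 269 ∷ []) ∷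
  (93 ∷ 2248 ∷ 987 ∷ 1434 ∷ 1186 ∷ 91 ∷ 2166 ∷ 1105 ∷ 1403 ∷ []) ∷
  (93 ∷ 2410 ∷ 1797 ∷ 462 ∷ 1024 ∷ 91 ∷ 2328 ∷ 1915 ∷ 431 ∷ []) ∷
  (93 ∷ 2572 ∷ 177 ∷ 948 ∷ 1672 ∷ 91 ∷ 2490 ∷ 295 ∷ 917 ∷ []) ∷
  (53 ∷ 90 ∷ 96 ∷ 105 ∷ 73 ∷ 0 ∷ 14 ∷ 85 ∷ 107 ∷ []) ∷
  (53 ∷ 252 ∷ 744 ∷ 591 ∷ 397 ∷ 0 ∷ 176 ∷ 733 ∷ 593 ∷ []) ∷
  (53 ∷ 414 ∷ 582 ∷ 1887 ∷ 1531 ∷ 0 ∷ 338 ∷ 571 ∷ 1889 ∷ []) ∷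
  (53 ∷ 576 ∷ 420 ∷ 2535 ∷ 721 ∷ 0 ∷ 500 ∷ 409 ∷ 2537 ∷ []) ∷
  (53 ∷ 738 ∷ 2526 ∷ 2049 ∷ 1369 ∷ 0 ∷ 662 ∷ 2515 ∷ 2051 ∷ []) ∷
  (53 ∷ 900 ∷ 1716 ∷ 753 ∷ 235 ∷ 0 ∷ 824 ∷ 1705 ∷ 755 ∷ []) ∷
  (53 ∷ 1062 ∷ 2364 ∷ 2211 ∷ 559 ∷ 0 ∷ 986 ∷ 2353 ∷ 2213 ∷ []) ∷
  (53 ∷ 1224 ∷ 2202 ∷ 1563 ∷ 2017 ∷ 0 ∷ 1148 ∷ 2191 ∷ 1565 ∷ []) ∷
  (53 ∷ 1386 ∷ 2040 ∷ 1077 ∷ 2341 ∷ 0 ∷ 1310 ∷ 2029 ∷ 1079 ∷ []) ∷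
  (53 ∷ 1548 ∷ 1230 ∷ 1725 ∷ 1855 ∷ 0 ∷ 1472 ∷ 1219 ∷ 1727 ∷ []) ∷
  (53 ∷ 1710 ∷ 906 ∷ 1239 ∷ 2179 ∷ 0 ∷ 1634 ∷ 895 ∷ 1241 ∷ []) ∷
  (53 ∷ 1872 ∷ 1554 ∷ 2373 ∷ 883 ∷ 0 ∷ 1796 ∷ 1543 ∷ 2375 ∷ []) ∷
  (53 ∷ 2034 ∷ 1392 ∷ 267 ∷ 2503 ∷ 0 ∷ 1958 ∷ 1381 ∷ 269 ∷ []) ∷
  (53 ∷ 2196 ∷ 1068 ∷ 1401 ∷ 1207 ∷ 0 ∷ 2120 ∷ 1057 ∷ 1403 ∷ []) ∷
  (53 ∷ 2358 ∷ 1878 ∷ 429 ∷ 1045 ∷ 0 ∷ 2282 ∷ 1867 ∷ 431 ∷ []) ∷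
  (53 ∷ 2520 ∷ 258 ∷ 915 ∷ 1693 ∷ 0 ∷ 2444 ∷ 247 ∷ 917 ∷ []) ∷
  []

-- Families obtained from the tables

abstract
  family₉ : Fam 4 8 1 9 1
  family₉ = Table.fam 4 8 9 1 1 rows₉ refl tt tt

  family₂₇ : Fam 4 8 1 27 1
  family₂₇ = Table.fam 4 8 27 1 1 rows₂₇ refl tt tt

  family₈₁ : Fam 4 8 1 81 1
  family₈₁ = Table.fam 4 8 81 1 1 rows₈₁ refl tt tt

  family₃ₓ₃ : Fam 4 8 1 3 3
  family₃ₓ₃ = Table.fam 4 8 3 3 1 rows₃ₓ₃ refl tt tt

  family₉ₓ₃ : Fam 4 8 1 9 3
  family₉ₓ₃ = Table.fam 4 8 9 3 1 rows₉ₓ₃ refl tt tt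

  diffMatrix₂₇ : DiffMatrix 27 1
  diffMatrix₂₇ = MatrixTable.diffMatrix 27 1 matrix₂₇ refl tt

  diffMatrix₃ₓ₃ : DiffMatrix 3 3
  diffMatrix₃ₓ₃ = MatrixTable.diffMatrix 3 3 matrix₃ₓ₃ refl tt

  -- The four tests do not mention r: one computation serves every modulus prime to 6.
  familyₚ : ∀ r → Coprime (suc (2 * r)) 24 → Fam 4 8 1 (suc (2 * r)) 1
  familyₚ r c = Dynamic.Family.fam 4 8 2 blocks₄ₓ₈ 1 r refl c tt tt tt tt

  family₁₂ₓ₈ : ∀ r → Coprime (suc (2 * r)) 24 → Fam 12 8 3 (suc (2 * r)) 1
  family₁₂ₓ₈ r c = Dynamic.Family.fam 12 8 6 blocks₁₂ₓ₈ 3 r refl c tt tt tt tt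

  family₄ₓ₂₄ : ∀ r → Coprime (suc (2 * r)) 24 → Fam 4 24 3 (suc (2 * r)) 1
  family₄ₓ₂₄ r c = Dynamic.Family.fam 4 24 6 blocks₄ₓ₂₄ 3 r refl c tt tt tt tt

-- Packings

-- The count is the largest one possible when 32 divides m n: zero is never a difference, so c pairs
-- satisfy 32 c < m n.
record Packing (m n : ℕ) : Set₁ where
  field
    Ix     : Set
    ixs    : List Ix
    unique : Unique ixs
    size   : suc (length ixs) * 32 ≡ m * n
    g      : Ix → Block
    inj    : ∀ i j a b → Valid a → Valid b → Same m n (diff (g i) a) (diff (g j) b) → (i , a) ≡ (j , b)

cg-0 : ∀ n a b → Cg n (a ℤ.- b) 0ℤ → Cg n a b
cg-0 n a b (k , e) = k , trans (lem₁ a b) (trans (cong (ℤ._+ b) e) (lem₂ b k (+ n)))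
  where
  lem₁ : ∀ a b → a ≡ (a ℤ.- b) ℤ.+ b
  lem₁ = solve-∀
  lem₂ : ∀ b k n → (0ℤ ℤ.+ k ℤ.* n) ℤ.+ b ≡ b ℤ.+ k ℤ.* n
  lem₂ = solve-∀

∣⇒cg : ∀ n a b → (+ n) Signed.∣ (a ℤ.- b) → Cg n a b
∣⇒cg n a b (Signed.divides q e) = cg-0 n a b (q , trans e (sym (ℤ.+-identityˡ (q ℤ.* + n))))

-- The two components of Z_{m u} ≅ Z_m × Z_u.
cg-component : ∀ m u → Coprime m u → ∀ a x b y →
  Cg (m * u) (+ u ℤ.* a ℤ.+ + m ℤ.* x) (+ u ℤ.* b ℤ.+ + m ℤ.* y) → Cg m a b
cg-component m u c a x b y (k , e) = ∣⇒cg m a b (Signed.∣ᵤ⇒∣ {+ m} {a ℤ.- b}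
  (coprime-divisor c (subst (m ∣_) (ℤ.abs-* (+ u) (a ℤ.- b)) (Signed.∣⇒∣ᵤ {+ m} {+ u ℤ.* (a ℤ.- b)} (Signed.divides (y ℤ.- x ℤ.+ k ℤ.* + u) eq)))))
  where
  open ≡-Reasoning
  lem₁ : ∀ u m a b x → u ℤ.* (a ℤ.- b) ≡ (u ℤ.* a ℤ.+ m ℤ.* x) ℤ.- (u ℤ.* b ℤ.+ m ℤ.* x)
  lem₁ = solve-∀
  lem₂ : ∀ u m b x y k → (u ℤ.* b ℤ.+ m ℤ.* y ℤ.+ k ℤ.* (m ℤ.* u)) ℤ.- (u ℤ.* b ℤ.+ m ℤ.* x) ≡ (y ℤ.- x ℤ.+ k ℤ.* u) ℤ.* m
  lem₂ = solve-∀
  eq : + u ℤ.* (a ℤ.- b) ≡ (y ℤ.- x ℤ.+ k ℤ.* + u) ℤ.* + m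
  eq = begin
    + u ℤ.* (a ℤ.- b)                                                ≡⟨ lem₁ (+ u) (+ m) a b x ⟩
    (+ u ℤ.* a ℤ.+ + m ℤ.* x) ℤ.- (+ u ℤ.* b ℤ.+ + m ℤ.* x)          ≡⟨ cong (ℤ._- (+ u ℤ.* b ℤ.+ + m ℤ.* x)) e ⟩
    (+ u ℤ.* b ℤ.+ + m ℤ.* y ℤ.+ k ℤ.* + (m * u)) ℤ.- (+ u ℤ.* b ℤ.+ + m ℤ.* x)
      ≡⟨ cong (λ z → (+ u ℤ.* b ℤ.+ + m ℤ.* y ℤ.+ k ℤ.* z) ℤ.- (+ u ℤ.* b ℤ.+ + m ℤ.* x)) (ℤ.pos-* m u) ⟩
    (+ u ℤ.* b ℤ.+ + m ℤ.* y ℤ.+ k ℤ.* (+ m ℤ.* + u)) ℤ.- (+ u ℤ.* b ℤ.+ + m ℤ.* x)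
      ≡⟨ lem₂ (+ u) (+ m) b x y k ⟩
    (y ℤ.- x ℤ.+ k ℤ.* + u) ℤ.* + m                                  ∎

-- Filling the base group

module Fill {m n q u v} (F : Fam m n q u v) (P : Packing m n) (32q : 32 * q ≡ m * n)
            (cu : Coprime m u) (cv : Coprime n v) where
  private
    module F = Fam F
    module P = Packing P

  Ix : Set
  Ix = F.Ix ⊎ P.Ix

  ixs : List Ix
  ixs = map inj₁ F.ixs ++ map inj₂ P.ixs

  O : Pt
  O = 0ℤ , 0ℤ

  -- The map (a , x) ↦ u a + m x identifies Z_m × Z_u with Z_{m u} when m and u are coprime. Being
  -- linear, it commutes with differences.
  join : Pt → Pt → Pt
  join (a , b) (x , y) = + u ℤ.* a ℤ.+ + m ℤ.* x , + v ℤ.* b ℤ.+ + n ℤ.* y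

  g : Ix → Block
  g (inj₁ i) κ s = join (F.g i κ s) (F.h i κ s)
  g (inj₂ i) κ s = join (P.g i κ s) O

  private
    rearrange : ∀ u m a x b y → (u ℤ.* a ℤ.+ m ℤ.* x) ℤ.- (u ℤ.* b ℤ.+ m ℤ.* y) ≡ u ℤ.* (a ℤ.- b) ℤ.+ m ℤ.* (x ℤ.- y)
    rearrange = solve-∀

    flip : ∀ m u {a x b y} → Cg (m * u) (+ u ℤ.* a ℤ.+ + m ℤ.* x) (+ u ℤ.* b ℤ.+ + m ℤ.* y) →
           Cg (u * m) (+ m ℤ.* x ℤ.+ + u ℤ.* a) (+ m ℤ.* y ℤ.+ + u ℤ.* b)
    flip m u {a} {x} {b} {y} c = subst₂ (Cg (u * m)) (ℤ.+-comm (+ u ℤ.* a) (+ m ℤ.* x)) (ℤ.+-comm (+ u ℤ.* b) (+ m ℤ.* y))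
      (subst (λ k → Cg k (+ u ℤ.* a ℤ.+ + m ℤ.* x) (+ u ℤ.* b ℤ.+ + m ℤ.* y)) (ℕ.*-comm m u) c)

    components : ∀ m u → Coprime m u → ∀ a x b y a′ x′ b′ y′ →
      Cg (m * u) ((+ u ℤ.* a ℤ.+ + m ℤ.* x) ℤ.- (+ u ℤ.* b ℤ.+ + m ℤ.* y))
                 ((+ u ℤ.* a′ ℤ.+ + m ℤ.* x′) ℤ.- (+ u ℤ.* b′ ℤ.+ + m ℤ.* y′)) →
      Cg m (a ℤ.- b) (a′ ℤ.- b′) × Cg u (x ℤ.- y) (x′ ℤ.- y′)
    components m u c a x b y a′ x′ b′ y′ e =
      cg-component m u c (a ℤ.- b) (x ℤ.- y) (a′ ℤ.- b′) (x′ ℤ.- y′) e′ ,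
      cg-component u m (Coprimality.sym c) (x ℤ.- y) (a ℤ.- b) (x′ ℤ.- y′) (a′ ℤ.- b′)
        (flip m u {a ℤ.- b} {x ℤ.- y} {a′ ℤ.- b′} {x′ ℤ.- y′} e′)
      where
      e′ : Cg (m * u) (+ u ℤ.* (a ℤ.- b) ℤ.+ + m ℤ.* (x ℤ.- y)) (+ u ℤ.* (a′ ℤ.- b′) ℤ.+ + m ℤ.* (x′ ℤ.- y′))
      e′ = subst₂ (Cg (m * u)) (rearrange (+ u) (+ m) a x b y) (rearrange (+ u) (+ m) a′ x′ b′ y′) e

  split : ∀ A X B Y A′ X′ B′ Y′ → Same (m * u) (n * v) (join A X ⊖ join B Y) (join A′ X′ ⊖ join B′ Y′) →
    Same m n (A ⊖ B) (A′ ⊖ B′) × Same u v (X ⊖ Y) (X′ ⊖ Y′)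
  split (a , a₂) (x , x₂) (b , b₂) (y , y₂) (a′ , a₂′) (x′ , x₂′) (b′ , b₂′) (y′ , y₂′) (e , f) =
    let (p , q) = components m u cu a x b y a′ x′ b′ y′ e ; (p₂ , q₂) = components n v cv a₂ x₂ b₂ y₂ a₂′ x₂′ b₂′ y₂′ f in
    (p , p₂) , (q , q₂)

  -- Differences of `P` have zero component in Z_u × Z_v and those of `F` never do, so the two sorts
  -- of blocks cannot interfere.
  inj : ∀ i j a b → Valid a → Valid b → Same (m * u) (n * v) (diff (g i) a) (diff (g j) b) → (i , a) ≡ (j , b)
  inj (inj₁ i) (inj₁ j) a@(κ , s , t) b@(κ′ , s′ , t′) va vb e =
    let eg , eh = split (F.g i κ s) (F.h i κ s) (F.g i κ t) (F.h i κ t) (F.g j κ′ s′) (F.h j κ′ s′) (F.g j κ′ t′) (F.h j κ′ t′) e in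
    cong (λ (i , a) → inj₁ i , a) (F.inj i j a b va vb eg eh)
  inj (inj₂ i) (inj₂ j) a@(κ , s , t) b@(κ′ , s′ , t′) va vb e =
    let eg , _ = split (P.g i κ s) O (P.g i κ t) O (P.g j κ′ s′) O (P.g j κ′ t′) O e in
    cong (λ (i , a) → inj₂ i , a) (P.inj i j a b va vb eg)
  inj (inj₁ i) (inj₂ j) a@(κ , s , t) (κ′ , s′ , t′) va vb e =
    let _ , eh = split (F.g i κ s) (F.h i κ s) (F.g i κ t) (F.h i κ t) (P.g j κ′ s′) O (P.g j κ′ t′) O e in
    ⊥-elim (F.off i a va eh)
  inj (inj₂ i) (inj₁ j) (κ , s , t) b@(κ′ , s′ , t′) va vb (e , f) =
    let _ , eh = split (F.g j κ′ s′) (F.h j κ′ s′) (F.g j κ′ t′) (F.h j κ′ t′) (P.g i κ s) O (P.g i κ t) O (cg-sym e , cg-sym f) in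
    ⊥-elim (F.off j b vb eh)

  unique : Unique ixs
  unique = Unique.++⁺ (Unique.map⁺ (λ { refl → refl }) F.unique) (Unique.map⁺ (λ { refl → refl }) P.unique)
                      (λ (x , y) → disjoint-sum (∈-map⁻ inj₁ x) (∈-map⁻ inj₂ y))
    where
    disjoint-sum : ∀ {z : Ix} → (∃ λ x → _ × z ≡ inj₁ x) → (∃ λ y → _ × z ≡ inj₂ y) → ⊥
    disjoint-sum (_ , _ , refl) (_ , _ , ())

  -- With 32 q = m n, the family contributes m n (u v - 1) differences and the packing m n - 32.
  size : suc (length ixs) * 32 ≡ (m * u) * (n * v)
  size = begin
    suc (length ixs) * 32                                 ≡⟨ cong (λ z → suc z * 32) (trans (length-++ (map inj₁ F.ixs))
                                                               (cong₂ ℕ._+_ (length-map inj₁ F.ixs) (length-map inj₂ P.ixs))) ⟩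
    suc (length F.ixs ℕ.+ length P.ixs) * 32              ≡⟨ lem₁ (length F.ixs) (length P.ixs) ⟩
    32 * length F.ixs ℕ.+ suc (length P.ixs) * 32         ≡⟨ cong (32 * length F.ixs ℕ.+_) (trans P.size (sym 32q)) ⟩
    32 * length F.ixs ℕ.+ 32 * q                          ≡⟨ lem₂ (length F.ixs) q ⟩
    32 * (q ℕ.+ length F.ixs)                             ≡⟨ cong (32 *_) F.size ⟩
    32 * (q * (u * v))                                    ≡⟨ sym (ℕ.*-assoc 32 q (u * v)) ⟩
    32 * q * (u * v)                                      ≡⟨ cong (_* (u * v)) 32q ⟩
    m * n * (u * v)                                       ≡⟨ lem₃ m n u v ⟩
    (m * u) * (n * v)                                     ∎
    where
    open ≡-Reasoning
    lem₁ : ∀ a b → suc (a ℕ.+ b) * 32 ≡ 32 * a ℕ.+ suc b * 32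
    lem₁ = ℕSolver.solve-∀
    lem₂ : ∀ a q → 32 * a ℕ.+ 32 * q ≡ 32 * (q ℕ.+ a)
    lem₂ = ℕSolver.solve-∀
    lem₃ : ∀ m n u v → m * n * (u * v) ≡ (m * u) * (n * v)
    lem₃ = ℕSolver.solve-∀

  packing : Packing (m * u) (n * v)
  packing = record { Ix = Ix ; ixs = ixs ; unique = unique ; size = size ; g = g ; inj = inj }

-- Lists without repetition

unique-map : ∀ {A B : Set} (f : A → B) xs → Unique xs → (∀ {x y} → x ∈ xs → y ∈ xs → f x ≡ f y → x ≡ y) → Unique (map f xs)
unique-map f []       u       i = []
unique-map f (x ∷ xs) (p ∷ u) i =
  All.map⁺ (All.tabulate (λ m e → All.lookup p m (i (here refl) (there m) e)))
  ∷ unique-map f xs u (λ m n → i (there m) (there n))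

unique-concatMap : ∀ {A B : Set} (f : A → List B) xs → Unique xs → (∀ {x} → x ∈ xs → Unique (f x)) →
  (∀ {x y z} → x ∈ xs → y ∈ xs → z ∈ f x → z ∈ f y → x ≡ y) → Unique (concatMap f xs)
unique-concatMap f []       u       each apart = []
unique-concatMap f (x ∷ xs) (p ∷ u) each apart =
  Unique.++⁺ (each (here refl)) (unique-concatMap f xs u (λ m → each (there m)) (λ m n → apart (there m) (there n)))
    (λ (m , n) → clash m (∈-concatMap⁻ f n))
  where
  clash : ∀ {z} → z ∈ f x → Any (λ y → z ∈ f y) xs → ⊥
  clash {z} m a = go (λ q → q) a
    where
    go : ∀ {ys} → (∀ {y} → y ∈ ys → y ∈ xs) → Any (λ y → z ∈ f y) ys → ⊥
    go sub (here n)  = All.lookup p (sub (here refl)) (apart (here refl) (there (sub (here refl))) m n)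
    go sub (there a) = go (λ q → sub (there q)) a

unique-length-≤ : ∀ {A : Set} (xs ys : List A) → Unique xs → (∀ {x} → x ∈ xs → x ∈ ys) → length xs ≤ length ys
unique-length-≤ []       ys u       sub = z≤n
unique-length-≤ (x ∷ xs) ys (p ∷ u) sub with ∈-∃++ (sub (here refl))
... | as , bs , refl = ℕ.≤-trans (s≤s (unique-length-≤ xs (as ++ bs) u sub′)) (ℕ.≤-reflexive len)
  where
  sub′ : ∀ {y} → y ∈ xs → y ∈ as ++ bs
  sub′ m with ∈-++⁻ as (sub (there m))
  ... | inj₁ n            = ∈-++⁺ˡ n
  ... | inj₂ (here refl)  = ⊥-elim (All.lookup p m refl)
  ... | inj₂ (there n)    = ∈-++⁺ʳ as n
  len : suc (length (as ++ bs)) ≡ length (as ++ x ∷ bs)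
  len = trans (cong suc (length-++ as)) (trans (sym (ℕ.+-suc (length as) (length bs))) (sym (length-++ as)))

-- From packings to blocks of residues

numBlocks-++ : ∀ k Bs Cs → numBlocks k (Bs ++ Cs) ≡ numBlocks k Bs ℕ.+ numBlocks k Cs
numBlocks-++ k Bs Cs = trans (cong length (filter-++ (λ B → length B ℕ.≟ k) Bs Cs))
  (length-++ (filter (λ B → length B ℕ.≟ k) Bs))

numBlocks-all : ∀ k Bs → All (λ B → length B ≡ k) Bs → numBlocks k Bs ≡ length Bs
numBlocks-all k Bs p = cong length (filter-all (λ B → length B ℕ.≟ k) p)

numBlocks-none : ∀ k Bs → All (λ B → length B ≢ k) Bs → numBlocks k Bs ≡ 0
numBlocks-none k Bs p = cong length (filter-none (λ B → length B ℕ.≟ k) p)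

modℕ-% : ∀ m .{{_ : NonZero m}} x → modℕ m x ≡ x % m
modℕ-% (suc k) x = refl

%-cg : ∀ m .{{_ : NonZero m}} x → Cg m (+ (x % m)) (+ x)
%-cg m x = cg-sym (+ (x / m) , trans (cong +_ (ℕ.m≡m%n+[m/n]*n x m)) (cong (λ z → + (x % m) ℤ.+ z) (ℤ.pos-* (x / m) m)))

%ℕ-cg : ∀ m .{{_ : NonZero m}} z → Cg m (+ (z %ℕ m)) z
%ℕ-cg m z = cg-sym (z /ℕ m , ℤ.a≡a%ℕn+[a/ℕn]*n z m)

cg-minus : ∀ {m a b c d} → Cg m a c → Cg m b d → Cg m (a ℤ.- b) (c ℤ.- d)
cg-minus {m} {a} {b} {c} {d} (k , e) (l , f) = k ℤ.- l , trans (cong₂ ℤ._-_ e f) (lem c d k l (+ m))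
  where
  lem : ∀ c d k l m → (c ℤ.+ k ℤ.* m) ℤ.- (d ℤ.+ l ℤ.* m) ≡ (c ℤ.- d) ℤ.+ (k ℤ.- l) ℤ.* m
  lem = solve-∀

sub-cg : ∀ m .{{_ : NonZero m}} a b → Cg m (+ modℕ m (a %ℕ m ℕ.+ (m ℕ.∸ b %ℕ m))) (a ℤ.- b)
sub-cg m a b = cg-trans (cg-reflexive (cong +_ (modℕ-% m (a %ℕ m ℕ.+ (m ℕ.∸ b %ℕ m)))))
  (cg-trans (%-cg m (a %ℕ m ℕ.+ (m ℕ.∸ b %ℕ m))) (cg-trans wrap (cg-minus (%ℕ-cg m a) (%ℕ-cg m b))))
  where
  wrap : Cg m (+ (a %ℕ m ℕ.+ (m ℕ.∸ b %ℕ m))) (+ (a %ℕ m) ℤ.- + (b %ℕ m))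
  wrap = + 1 , (begin
    + (a %ℕ m) ℤ.+ + (m ℕ.∸ b %ℕ m)                                        ≡⟨ lem (+ (a %ℕ m)) (+ (m ℕ.∸ b %ℕ m)) (+ (b %ℕ m)) ⟩
    (+ (a %ℕ m) ℤ.- + (b %ℕ m)) ℤ.+ + 1 ℤ.* (+ (m ℕ.∸ b %ℕ m) ℤ.+ + (b %ℕ m))
      ≡⟨ cong (λ z → (+ (a %ℕ m) ℤ.- + (b %ℕ m)) ℤ.+ + 1 ℤ.* + z) (ℕ.m∸n+n≡m (ℕ.<⇒≤ (ℤ.n%ℕd<d b m))) ⟩
    (+ (a %ℕ m) ℤ.- + (b %ℕ m)) ℤ.+ + 1 ℤ.* + m                            ∎)
    where
    open ≡-Reasoning
    lem : ∀ a c b → a ℤ.+ c ≡ (a ℤ.- b) ℤ.+ + 1 ℤ.* (c ℤ.+ b)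
    lem = solve-∀

module Blocks {m n} .{{_ : NonZero m}} .{{_ : NonZero n}} (P : Packing m n) where

  open Packing P

  residue : Pt → Elt
  residue (a , b) = a %ℕ m , b %ℕ n

  elt : Ix → Kind → Fin 5 → Elt
  elt i κ s = residue (g i κ s)

  rows : Kind → List (Fin 5)
  rows five = 0F ∷ 1F ∷ 2F ∷ 3F ∷ 4F ∷ []
  rows four = 0F ∷ 1F ∷ 2F ∷ 3F ∷ []

  rows-unique : ∀ κ → Unique (rows κ)
  rows-unique five = Unique.allFin⁺ 5
  rows-unique four = unique-++ˡ (rows four) {4F ∷ []} (Unique.allFin⁺ 5)

  ∈-rows⇒row : ∀ κ {s} → s ∈ rows κ → T (row κ s)
  ∈-rows⇒row five _ = tt
  ∈-rows⇒row four (here refl) = tt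
  ∈-rows⇒row four (there (here refl)) = tt
  ∈-rows⇒row four (there (there (here refl))) = tt
  ∈-rows⇒row four (there (there (there (here refl)))) = tt

  rows⇒valid : ∀ κ {s t} → s ∈ rows κ → t ∈ rows κ → s ≢ t → Valid (κ , s , t)
  rows⇒valid κ {s} {t} p q ne = T-∧⁺ {row κ s} (∈-rows⇒row κ p) (T-∧⁺ {row κ t} (∈-rows⇒row κ q)
    (T-not⁺ (λ e → ne (==⇒≡ s t e))))

  block : Kind → Ix → List Elt
  block κ i = map (elt i κ) (rows κ)

  minus : Pt → Pt → Elt
  minus p q = subG m n (residue p) (residue q)

  minus-same : ∀ p q p′ q′ → minus p q ≡ minus p′ q′ → Same m n (p ⊖ q) (p′ ⊖ q′)
  minus-same (a , b) (c , d) (a′ , b′) (c′ , d′) e =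
    cg-trans (cg-sym (sub-cg m a c)) (cg-trans (cg-reflexive (cong (λ z → + proj₁ z) e)) (sub-cg m a′ c′)) ,
    cg-trans (cg-sym (sub-cg n b d)) (cg-trans (cg-reflexive (cong (λ z → + proj₂ z) e)) (sub-cg n b′ d′))

  minus-injective : ∀ i j a b → Valid a → Valid b →
    let (κ , s , t) = a ; (κ′ , s′ , t′) = b in
    minus (g i κ s) (g i κ t) ≡ minus (g j κ′ s′) (g j κ′ t′) → (i , a) ≡ (j , b)
  minus-injective i j a@(κ , s , t) b@(κ′ , s′ , t′) va vb e =
    inj i j a b va vb (minus-same (g i κ s) (g i κ t) (g j κ′ s′) (g j κ′ t′) e)

  private
    reversed : ∀ {i : Ix} {κ s t} → T (valid κ s t) → (i , κ , s , t) ≢ (i , κ , t , s)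
    reversed {i} {κ} v e = valid⇒≢ κ v (cong (λ z → proj₁ (proj₂ (proj₂ z))) e)

  -- If two rows gave the same element, the slots (s , t) and (t , s) would have the same
  -- difference.
  elt-injective : ∀ i κ {s t} → s ∈ rows κ → t ∈ rows κ → elt i κ s ≡ elt i κ t → s ≡ t
  elt-injective i κ {s} {t} p q e with s Fin.≟ t
  ... | yes s≡t = s≡t
  ... | no  s≢t = ⊥-elim (reversed {i} v (minus-injective i i (κ , s , t) (κ , t , s) v (valid-sym κ s t v) (cong₂ (subG m n) e (sym e))))
    where
    v : Valid (κ , s , t)
    v = rows⇒valid κ p q s≢t

  block-unique : ∀ κ i → Unique (block κ i)
  block-unique κ i = unique-map (elt i κ) (rows κ) (rows-unique κ) (elt-injective i κ)

  private
    others : Elt → List Elt → List Elt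
    others x B = map (λ y → subG m n x y) (filter (λ y → ¬? (x ≟ₑ y)) B)

  ∈-others : ∀ κ i {s z} → s ∈ rows κ → z ∈ others (elt i κ s) (block κ i) →
    ∃ λ t → Valid (κ , s , t) × t ∈ rows κ × z ≡ minus (g i κ s) (g i κ t)
  ∈-others κ i {s} p z∈ with ∈-map⁻ (λ y → subG m n (elt i κ s) y) z∈
  ... | y , y∈ , z≡ with ∈-filter⁻ (λ y → ¬? (elt i κ s ≟ₑ y)) {xs = block κ i} y∈
  ...   | y∈B , ne with ∈-map⁻ (elt i κ) y∈B
  ...     | t , t∈ , refl = t , rows⇒valid κ p t∈ (λ e → ne (cong (elt i κ) e)) , t∈ , z≡

  IsDifference : Kind → Ix → Elt → Set
  IsDifference κ i z = ∃ λ a → Valid a × proj₁ a ≡ κ ×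
    z ≡ minus (g i (proj₁ a) (proj₁ (proj₂ a))) (g i (proj₁ a) (proj₂ (proj₂ a)))

  ∈-Δ : ∀ κ i {z} → z ∈ Δ m n (block κ i) → IsDifference κ i z
  ∈-Δ κ i {z} z∈ = go (rows κ) (λ p → p) (∈-concatMap⁻ (λ x → others x (block κ i)) {xs = block κ i} z∈)
    where
    go : ∀ ss → (∀ {s} → s ∈ ss → s ∈ rows κ) → Any (λ x → z ∈ others x (block κ i)) (map (elt i κ) ss) → IsDifference κ i z
    go (s ∷ ss) sub (here n)  = let (t , v , _ , e) = ∈-others κ i (sub (here refl)) n in (κ , s , t) , v , refl , e
    go (s ∷ ss) sub (there a) = go ss (λ q → sub (there q)) a

  Δ-unique : ∀ κ i → Unique (Δ m n (block κ i))
  Δ-unique κ i = unique-concatMap (λ x → others x (block κ i)) (block κ i) (block-unique κ i) each apart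
    where
    each : ∀ {x} → x ∈ block κ i → Unique (others x (block κ i))
    each {x} x∈ with ∈-map⁻ (elt i κ) x∈
    ... | s , s∈ , refl = unique-map (λ y → subG m n x y) _ (Unique.filter⁺ (λ y → ¬? (x ≟ₑ y)) (block-unique κ i)) inner
      where
      inner : ∀ {y y′} → y ∈ filter (λ y → ¬? (x ≟ₑ y)) (block κ i) → y′ ∈ filter (λ y → ¬? (x ≟ₑ y)) (block κ i) →
              subG m n x y ≡ subG m n x y′ → y ≡ y′
      inner y∈ y′∈ e with ∈-filter⁻ (λ y → ¬? (x ≟ₑ y)) {xs = block κ i} y∈ | ∈-filter⁻ (λ y → ¬? (x ≟ₑ y)) {xs = block κ i} y′∈
      ... | y∈B , ne | y′∈B , ne′ with ∈-map⁻ (elt i κ) y∈B | ∈-map⁻ (elt i κ) y′∈B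
      ...   | t , t∈ , refl | t′ , t′∈ , refl = cong (λ z → elt i κ (proj₂ (proj₂ (proj₂ z))))
                (minus-injective i i (κ , s , t) (κ , s , t′) (rows⇒valid κ s∈ t∈ (λ e → ne (cong (elt i κ) e)))
                  (rows⇒valid κ s∈ t′∈ (λ e → ne′ (cong (elt i κ) e))) e)
    apart : ∀ {x y z} → x ∈ block κ i → y ∈ block κ i → z ∈ others x (block κ i) → z ∈ others y (block κ i) → x ≡ y
    apart x∈ y∈ z∈ z∈′ with ∈-map⁻ (elt i κ) x∈ | ∈-map⁻ (elt i κ) y∈
    ... | s , s∈ , refl | s′ , s′∈ , refl with ∈-others κ i s∈ z∈ | ∈-others κ i s′∈ z∈′
    ...   | t , v , _ , e | t′ , v′ , _ , e′ = cong (λ z → elt i κ (proj₁ (proj₂ (proj₂ z))))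
              (minus-injective i i (κ , s , t) (κ , s′ , t′) v v′ (trans (sym e) e′))

  Δ-apart : ∀ κ κ′ i j {z} → z ∈ Δ m n (block κ i) → z ∈ Δ m n (block κ′ j) → (i , κ) ≡ (j , κ′)
  Δ-apart κ κ′ i j p q with ∈-Δ κ i p | ∈-Δ κ′ j q
  ... | a , va , refl , e | b , vb , refl , e′ = cong (λ (i , a) → i , proj₁ a)
        (minus-injective i j a b va vb (trans (sym e) e′))

  blocks : List (List Elt)
  blocks = map (block five) ixs ++ map (block four) ixs

  private
    concatMap-map′ : ∀ κ is → concatMap (Δ m n) (map (block κ) is) ≡ concatMap (λ i → Δ m n (block κ i)) is
    concatMap-map′ κ []       = refl
    concatMap-map′ κ (i ∷ is) = cong (Δ m n (block κ i) ++_) (concatMap-map′ κ is)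

    ∈-all-Δ : ∀ κ is {z} → z ∈ concatMap (λ i → Δ m n (block κ i)) is → ∃ λ i → z ∈ Δ m n (block κ i)
    ∈-all-Δ κ is z∈ = let a = ∈-concatMap⁻ (λ i → Δ m n (block κ i)) {xs = is} z∈ in Any.lookup a , lookup-result a

    kind-unique : ∀ κ → Unique (concatMap (λ i → Δ m n (block κ i)) ixs)
    kind-unique κ = unique-concatMap (λ i → Δ m n (block κ i)) ixs unique (λ {i} _ → Δ-unique κ i)
      (λ {i} {j} _ _ p q → cong proj₁ (Δ-apart κ κ i j p q))

    five≢four : five ≢ four
    five≢four ()

  Δ-blocks-unique : Unique (concatMap (Δ m n) blocks)
  Δ-blocks-unique = subst Unique (sym (trans (concatMap-++ (Δ m n) (map (block five) ixs) (map (block four) ixs))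
      (cong₂ _++_ (concatMap-map′ five ixs) (concatMap-map′ four ixs))))
    (Unique.++⁺ (kind-unique five) (kind-unique four) (λ (p , q) →
      let (i , p′) = ∈-all-Δ five ixs p ; (j , q′) = ∈-all-Δ four ixs q in
      five≢four (cong proj₂ (Δ-apart five four i j p′ q′))))

  private
    mapped : ∀ {R : List Elt → Set} κ → (∀ i → R (block κ i)) → All R (map (block κ) ixs)
    mapped κ p = All.map⁺ (All.tabulate (λ {i} _ → p i))

    everywhere : ∀ {R : List Elt → Set} → (∀ κ i → R (block κ i)) → All R blocks
    everywhere p = All.++⁺ (mapped five (p five)) (mapped four (p four))

  isPacking : DifferencePacking m n (4 ∷ 5 ∷ []) blocks
  isPacking = record
    { blocksInG  = everywhere (λ κ i → All.map⁺ (All.tabulate (λ {s} _ → ℤ.n%ℕd<d (proj₁ (g i κ s)) m , ℤ.n%ℕd<d (proj₂ (g i κ s)) n)))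
    ; blocksSets = everywhere block-unique
    ; blockSizes = everywhere (λ { five i → there (here refl) ; four i → here refl })
    ; packing    = Δ-blocks-unique
    }

  number : ∀ {k} → k ∈ (4 ∷ 5 ∷ []) → numBlocks k blocks ≡ length ixs
  number (here refl) = trans (numBlocks-++ 4 (map (block five) ixs) (map (block four) ixs))
    (cong₂ ℕ._+_ (numBlocks-none 4 _ (mapped five (λ _ ()))) (trans (numBlocks-all 4 _ (mapped four (λ _ → refl))) (length-map (block four) ixs)))
  number (there (here refl)) = trans (numBlocks-++ 5 (map (block five) ixs) (map (block four) ixs))
    (trans (cong₂ ℕ._+_ (trans (numBlocks-all 5 _ (mapped five (λ _ → refl))) (length-map (block five) ixs)) (numBlocks-none 5 _ (mapped four (λ _ ()))))
      (ℕ.+-identityʳ (length ixs)))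

  private
    NonInv : Elt → Set
    NonInv z = addG m n z z ≢ (0 , 0)

    nonInv? = λ (z : Elt) → ¬? (addG m n z z ≟ₑ (0 , 0))

    difference : Ix × Slot → Elt
    difference (i , κ , s , t) = minus (g i κ s) (g i κ t)

    -- Applied in both components, this turns a self-inverse difference into a collision of the
    -- slots (s , t) and (t , s).
    twice-0 : ∀ k .{{_ : NonZero k}} x y z → Cg k (+ z) (x ℤ.- y) → modℕ k (z ℕ.+ z) ≡ 0 → Cg k (x ℤ.- y) (y ℤ.- x)
    twice-0 k x y z c e = cg-trans (cg-0 k (x ℤ.- y) (ℤ.- (+ z))
        (cg-trans (cg-minus c′ cg-refl) (cg-trans (cg-reflexive (lem₁ (+ z))) (cg-trans (cg-sym (%-cg k (z ℕ.+ z)))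
          (cg-reflexive (cong +_ (trans (sym (modℕ-% k (z ℕ.+ z))) e)))))))
        (cg-trans (cg-reflexive (lem₂ (+ z))) (cg-trans (cg-minus {a = 0ℤ} cg-refl c) (cg-reflexive (lem₃ x y))))
      where
      c′ : Cg k (x ℤ.- y) (+ z)
      c′ = cg-sym c
      lem₁ : ∀ z → z ℤ.- (ℤ.- z) ≡ z ℤ.+ z
      lem₁ = solve-∀
      lem₂ : ∀ z → ℤ.- z ≡ 0ℤ ℤ.- z
      lem₂ = solve-∀
      lem₃ : ∀ x y → 0ℤ ℤ.- (x ℤ.- y) ≡ y ℤ.- x
      lem₃ = solve-∀

    difference-nonInv : ∀ i a → Valid a → NonInv (difference (i , a))
    difference-nonInv i a@(κ , s , t) v e = reversed {i} v (inj i i a (κ , t , s) v (valid-sym κ s t v)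
      ( twice-0 m (proj₁ (g i κ s)) (proj₁ (g i κ t)) _ (sub-cg m (proj₁ (g i κ s)) (proj₁ (g i κ t))) (cong proj₁ e)
      , twice-0 n (proj₂ (g i κ s)) (proj₂ (g i κ t)) _ (sub-cg n (proj₂ (g i κ s)) (proj₂ (g i κ t))) (cong proj₂ e)))

    modℕ-< : ∀ k .{{_ : NonZero k}} x → modℕ k x < k
    modℕ-< k x = subst (_< k) (sym (modℕ-% k x)) (ℕ.m%n<n x k)

    slots-unique : Unique slots
    slots-unique = Unique.filter⁺ (λ (κ , s , t) → T? (valid κ s t)) (Unique.cartesianProduct⁺ kinds-unique (Unique.cartesianProduct⁺ (Unique.allFin⁺ 5) (Unique.allFin⁺ 5)))
      where
      kinds-unique : Unique kinds
      kinds-unique = (five≢four ∷ []) ∷ [] ∷ []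

    slot-valid : ∀ {a} → a ∈ slots → Valid a
    slot-valid p = proj₂ (∈-filter⁻ (λ (κ , s , t) → T? (valid κ s t)) {xs = cartesianProduct kinds (cartesianProduct (allFin 5) (allFin 5))} p)

    differences : List Elt
    differences = map difference (cartesianProduct ixs slots)

    differences-unique : Unique differences
    differences-unique = unique-map difference (cartesianProduct ixs slots) (Unique.cartesianProduct⁺ unique slots-unique)
      (λ {x} {y} p q → minus-injective (proj₁ x) (proj₁ y) (proj₂ x) (proj₂ y)
        (slot-valid (proj₂ (∈-cartesianProduct⁻ ixs slots p))) (slot-valid (proj₂ (∈-cartesianProduct⁻ ixs slots q))))

    differences-⊆ : ∀ {z} → z ∈ differences → z ∈ filter nonInv? (elemsG m n)
    differences-⊆ z∈ with ∈-map⁻ difference z∈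
    ... | (i , a) , p , refl = ∈-filter⁺ nonInv?
            (∈-cartesianProduct⁺ (∈-upTo⁺ (modℕ-< m _)) (∈-upTo⁺ (modℕ-< n _)))
            (difference-nonInv i a (slot-valid (proj₂ (∈-cartesianProduct⁻ ixs slots p))))

    lower : length ixs * 32 ≤ nonInvCount m n
    lower = ℕ.≤-trans (ℕ.≤-reflexive (sym (trans (length-map difference (cartesianProduct ixs slots)) (length-cartesianProduct ixs slots))))
      (unique-length-≤ differences _ differences-unique differences-⊆)

    0<_ : ∀ k → .{{_ : NonZero k}} → 0 < k
    0< suc k = z<s

    modℕ-0 : ∀ k .{{_ : NonZero k}} → modℕ k 0 ≡ 0
    modℕ-0 (suc k) = refl

    -- The inequality is strict because the filter drops at least the zero element.
    upper : nonInvCount m n < suc (length ixs) * 32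
    upper = ℕ.<-≤-trans (filter-notAll nonInv? (elemsG m n) (Any.map (λ { refl p → p (cong₂ _,_ (modℕ-0 m) (modℕ-0 n)) })
        (∈-cartesianProduct⁺ (∈-upTo⁺ (0< m)) (∈-upTo⁺ (0< n)))))
      (ℕ.≤-reflexive (trans (length-cartesianProduct (upTo m) (upTo n)) (trans (cong₂ _*_ (length-upTo m) (length-upTo n)) (sym size))))

  -- The divisor of optimality is 32 = (16 - 4) + (25 - 5), and `lower` and `upper` enclose the
  -- count between consecutive multiples of it.
  count : nonInvCount m n / 32 ≡ length ixs
  count = ℕ.≤-antisym
    (ℕ.s≤s⁻¹ (ℕ.m<n*o⇒m/o<n {nonInvCount m n} {suc (length ixs)} {32} upper))
    (ℕ.≤-trans (ℕ.≤-reflexive (sym (ℕ.m*n/n≡m (length ixs) 32))) (ℕ./-monoˡ-≤ 32 lower))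

  optimal : OptimalBDP m n (4 ∷ 5 ∷ []) blocks
  optimal = record { isPacking = isPacking ; isBalanced = λ p q → trans (number p) (sym (number q)) }
          , λ p → trans (number p) (sym count)

-- The difference matrix of scalar multiples

gap∣24 : ∀ (s t : Fin 5) → s ≢ t → ℤ.∣ + toℕ s ℤ.- + toℕ t ∣ ∣ 24
gap∣24 = toWitness {a? = all? (λ s → all? (λ t → ¬? (s Fin.≟ t) →-dec (ℤ.∣ + toℕ s ℤ.- + toℕ t ∣ ∣? 24)))} tt

-- The factor s - t is one of ±1, ..., ±4, so its absolute value divides 24 and it cancels modulo w.
cg-scale : ∀ w → Coprime w 24 → ∀ (s t : Fin 5) → s ≢ t → ∀ x y →
  Cg w (+ toℕ s ℤ.* x ℤ.- + toℕ t ℤ.* x) (+ toℕ s ℤ.* y ℤ.- + toℕ t ℤ.* y) → Cg w x y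
cg-scale w c s t s≢t x y (k , e) = ∣⇒cg w x y (Signed.∣ᵤ⇒∣ {+ w} {x ℤ.- y} (coprime-divisor c (w∣24* (gap∣24 s t s≢t))))
  where
  d : ℤ
  d = + toℕ s ℤ.- + toℕ t
  lem₁ : ∀ s t x y → (s ℤ.- t) ℤ.* (x ℤ.- y) ≡ (s ℤ.* x ℤ.- t ℤ.* x) ℤ.- (s ℤ.* y ℤ.- t ℤ.* y)
  lem₁ = solve-∀
  lem₂ : ∀ a b → (a ℤ.+ b) ℤ.- a ≡ b
  lem₂ = solve-∀
  w∣d* : w ∣ ℤ.∣ d ∣ * ℤ.∣ x ℤ.- y ∣
  w∣d* = subst (w ∣_) (ℤ.abs-* d (x ℤ.- y)) (Signed.∣⇒∣ᵤ {+ w} {d ℤ.* (x ℤ.- y)} (Signed.divides k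
    (trans (lem₁ (+ toℕ s) (+ toℕ t) x y)
      (trans (cong (ℤ._- (+ toℕ s ℤ.* y ℤ.- + toℕ t ℤ.* y)) e) (lem₂ (+ toℕ s ℤ.* y ℤ.- + toℕ t ℤ.* y) (k ℤ.* + w))))))
  w∣24* : ℤ.∣ d ∣ ∣ 24 → w ∣ 24 * ℤ.∣ x ℤ.- y ∣
  w∣24* (divides q f) = subst (w ∣_) (trans (sym (ℕ.*-assoc q ℤ.∣ d ∣ ℤ.∣ x ℤ.- y ∣)) (cong (_* ℤ.∣ x ℤ.- y ∣) (sym f)))
    (∣-trans w∣d* (n∣m*n q))

cg-Fin : ∀ w .{{_ : NonZero w}} (x y : Fin w) → Cg w (+ toℕ x) (+ toℕ y) → x ≡ y
cg-Fin w x y c = toℕ-injective (trans (sym (ℕ.m<n⇒m%n≡m (toℕ<n x))) (trans (cg-%ℕ w (toℕ x) (toℕ y) c) (ℕ.m<n⇒m%n≡m (toℕ<n y))))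

scalarMatrix : ∀ u v .{{_ : NonZero u}} .{{_ : NonZero v}} → Coprime u 24 → Coprime v 24 → DiffMatrix u v
scalarMatrix u v cu cv = record
  { Ix     = Fin u × Fin v
  ; ixs    = cartesianProduct (allFin u) (allFin v)
  ; unique = Unique.cartesianProduct⁺ (Unique.allFin⁺ u) (Unique.allFin⁺ v)
  ; size   = trans (length-cartesianProduct (allFin u) (allFin v))
               (cong₂ _*_ (length-tabulate (λ (i : Fin u) → i)) (length-tabulate (λ (i : Fin v) → i)))
  ; entry  = λ (x , y) s → + toℕ s ℤ.* + toℕ x , + toℕ s ℤ.* + toℕ y
  ; inj    = λ (x , y) (x′ , y′) s t s≢t (e , f) →
      cong₂ _,_ (cg-Fin u x x′ (cg-scale u cu s t s≢t (+ toℕ x) (+ toℕ x′) e))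
                (cg-Fin v y y′ (cg-scale v cv s t s≢t (+ toℕ y) (+ toℕ y′) f))
  }

-- Families over the part of the group prime to six

odd : ℕ → ℕ
odd r = suc (2 * r)

coprime-1 : ∀ n → Coprime 1 n
coprime-1 n = Coprimality.1-coprimeTo n

-- The family over the first factor is inflated by a matrix over the second alone; the kernel is the
-- second factor, filled by its own family.
plane : ∀ {m n q} → (∀ r → Coprime (odd r) 24 → Fam m n q (odd r) 1) →
  ∀ r r′ → Coprime (odd r) 24 → Coprime (odd r′) 24 → Fam m n q (odd r) (odd r′)
plane {m} {n} {q} f r r′ c c′ = subst₂ (Fam m n q) (ℕ.*-identityʳ (odd r)) (ℕ.*-identityˡ (odd r′))
  (Lift.lift (f r c) (scalarMatrix 1 (odd r′) (coprime-1 24) c′) (swap (f r′ c′)))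

-- Families over the three-part of the group

family₁ : Fam 4 8 1 1 1
family₁ = Table.fam 4 8 1 1 1 [] refl tt tt

-- Inflation by Z_27 raises the exponent by 3, so the exponents 2, 3 and 4 start all cases.
cyclic : ∀ a → Fam 4 8 1 (3 ^ (2 ℕ.+ a)) 1
cyclic 0 = family₉
cyclic 1 = family₂₇
cyclic 2 = family₈₁
cyclic (suc (suc (suc a))) = subst (λ u → Fam 4 8 1 u 1) (lem (3 ^ a))
  (Lift.lift {{ℕ.m^n≢0 3 (2 ℕ.+ a)}} (cyclic a) diffMatrix₂₇ family₂₇)
  where
  lem : ∀ x → 3 * (3 * x) * 27 ≡ 3 * (3 * (3 * (3 * (3 * x))))
  lem = ℕSolver.solve-∀

diagonal : ∀ a b → Fam 4 8 1 (3 ^ a) (3 ^ b) → Fam 4 8 1 (3 ^ suc a) (3 ^ suc b)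
diagonal a b F = subst₂ (Fam 4 8 1) (ℕ.*-comm (3 ^ a) 3) (ℕ.*-comm (3 ^ b) 3)
  (Lift.lift {{ℕ.m^n≢0 3 a}} {{ℕ.m^n≢0 3 b}} F diffMatrix₃ₓ₃ family₃ₓ₃)

-- Removing Z_3 × Z_3 lowers both exponents by one, and must not end in (1 , 0) or (0 , 1). Hence (2
-- , 1) and (1 , 2) come from a table, whereas other pairs with an exponent 1, except (1 , 1),
-- descend to the cyclic case.
threes : ∀ a b → a ℕ.+ b ≢ 1 → Fam 4 8 1 (3 ^ a) (3 ^ b)
threes 0 0 _ = family₁
threes 0 1 ne = ⊥-elim (ne refl)
threes 1 0 ne = ⊥-elim (ne refl)
threes 0 (suc (suc b)) _ = swap (cyclic b)
threes (suc (suc a)) 0 _ = cyclic a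
threes 1 1 _ = family₃ₓ₃
threes 1 2 _ = swap family₉ₓ₃
threes 2 1 _ = family₉ₓ₃
threes 1 (suc (suc (suc b))) _ = diagonal 0 (2 ℕ.+ b) (threes 0 (2 ℕ.+ b) (λ ()))
threes (suc (suc (suc a))) 1 _ = diagonal (2 ℕ.+ a) 0 (threes (2 ℕ.+ a) 0 (λ ()))
threes (suc (suc a)) (suc (suc b)) _ = diagonal (suc a) (suc b) (threes (suc a) (suc b)
  (λ e → ℕ.1+n≢0 (trans (sym (ℕ.+-suc a b)) (ℕ.suc-injective e))))

-- Packings given by tables

cg-one : ∀ a b → Cg 1 a b
cg-one a b = a ℤ.- b , lem a b
  where
  lem : ∀ a b → a ≡ b ℤ.+ (a ℤ.- b) ℤ.* + 1
  lem = solve-∀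

tablePacking : ∀ m n .{{_ : NonZero m}} .{{_ : NonZero n}} rs → suc (length rs) * 32 ≡ m * n →
  T (distinct₃₂ (table (Table.key m n 1 1) slots rs)) → Packing m n
tablePacking m n rs l d = record
  { Ix = Fin (length rs)
  ; ixs = allFin (length rs)
  ; unique = Unique.allFin⁺ (length rs)
  ; size = trans (cong (λ z → suc z * 32) (length-tabulate (λ (i : Fin (length rs)) → i))) l
  ; g = λ i → Table.g m n 1 1 (lookup rs i)
  ; inj = λ i j a b va vb e → Table.inj m n 1 1 rs d i j a b va vb e (cg-one _ _ , cg-one _ _)
  }

-- Three-parts of odd numbers

abstract
  -- Reduces coprimality to 24, and to 8, to divisibility by 2 and 3; all numbers below 25 are
  -- inspected.
  ∣24 : ∀ {d} → d ∣ 24 → (d ≡ 1) ⊎ (2 ∣ d) ⊎ (3 ∣ d)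
  ∣24 {d} d∣24 = subst P (toℕ-fromℕ< d<25) (table24 (fromℕ< d<25) (subst (_∣ 24) (sym (toℕ-fromℕ< d<25)) d∣24))
    where
    P : ℕ → Set
    P d = (d ≡ 1) ⊎ (2 ∣ d) ⊎ (3 ∣ d)
    d<25 : d < 25
    d<25 = s≤s (∣⇒≤ d∣24)
    table24 : ∀ (d : Fin 25) → toℕ d ∣ 24 → P (toℕ d)
    table24 = toWitness {a? = all? (λ d → (toℕ d ∣? 24) →-dec ((toℕ d ℕ.≟ 1) ⊎-dec ((2 ∣? toℕ d) ⊎-dec (3 ∣? toℕ d))))} tt

¬2∣ : ∀ {n} → n % 2 ≡ 1 → ¬ (2 ∣ n)
¬2∣ {n} e d with trans (sym e) (n∣m⇒m%n≡0 n 2 d)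
... | ()

coprime-24 : ∀ n → n % 2 ≡ 1 → ¬ (3 ∣ n) → Coprime n 24
coprime-24 n e ¬3 {d} (d∣n , d∣24) = Sum.[ (λ d≡1 → d≡1) ,
  Sum.[ (λ 2∣d → ⊥-elim (¬2∣ e (∣-trans 2∣d d∣n))) , (λ 3∣d → ⊥-elim (¬3 (∣-trans 3∣d d∣n))) ]′ ]′ (∣24 d∣24)

record ThreePart (n : ℕ) : Set where
  constructor threePart
  field
    exponent half : ℕ
    factors       : n ≡ 3 ^ exponent * odd half
    coprime       : Coprime (odd half) 24

odd-half : ∀ n → n % 2 ≡ 1 → n ≡ odd (n ℕ./ 2)
odd-half n e = trans (ℕ.m≡m%n+[m/n]*n n 2) (cong₂ ℕ._+_ e (ℕ.*-comm (n ℕ./ 2) 2))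

odd-factor : ∀ q k → (q * k) % 2 ≡ 1 → q % 2 ≡ 1
odd-factor q k e with q % 2 in eq | ℕ.m%n<n q 2
... | 0 | _ = ⊥-elim (¬2∣ e (∣-trans (m%n≡0⇒n∣m q 2 eq) (m∣m*n k)))
... | 1 | _ = refl
... | suc (suc _) | s≤s (s≤s ())

decompose : ∀ n → n % 2 ≡ 1 → ThreePart n
decompose = <-rec _ go
  where
  go : ∀ n → (∀ {k} → k < n → k % 2 ≡ 1 → ThreePart k) → n % 2 ≡ 1 → ThreePart n
  go n rec e with 3 ∣? n
  ... | no ¬3 = threePart 0 (n ℕ./ 2) (trans (odd-half n e) (sym (ℕ.*-identityˡ (odd (n ℕ./ 2)))))
                  (subst (λ k → Coprime k 24) (odd-half n e) (coprime-24 n e ¬3))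
  ... | yes (divides q n≡q*3) with rec q<n (odd-factor q 3 (trans (cong (_% 2) (sym n≡q*3)) e))
    where
    q<n : q < n
    q<n = subst (q <_) (sym n≡q*3) (lt q (trans (cong (_% 2) (sym n≡q*3)) e))
      where
      lt : ∀ q → (q * 3) % 2 ≡ 1 → q < q * 3
      lt zero ()
      lt (suc q) _ = ℕ.m<m*n (suc q) 3 (s≤s (s≤s z≤n))
  ...   | threePart a r f c = threePart (suc a) r
            (trans n≡q*3 (trans (cong (_* 3) f) (trans (ℕ.*-comm (3 ^ a * odd r) 3) (sym (ℕ.*-assoc 3 (3 ^ a) (odd r))))))
            c

-- Assembly of the optimal packing

coprime-∣ : ∀ {w d e} → d ∣ e → Coprime w e → Coprime d w
coprime-∣ d∣e c (p , q) = c (q , ∣-trans p d∣e)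

coprime-8 : ∀ u → u % 2 ≡ 1 → Coprime 8 u
coprime-8 u e {d} (d∣8 , d∣u) = Sum.[ (λ d≡1 → d≡1) ,
  Sum.[ (λ 2∣d → ⊥-elim (¬2∣ e (∣-trans 2∣d d∣u))) , (λ 3∣d → ⊥-elim (3∤8 (∣-trans 3∣d d∣8))) ]′ ]′
  (∣24 (∣-trans d∣8 (divides 3 refl)))
  where
  3∤8 : ¬ (3 ∣ 8)
  3∤8 = toWitness {a? = ¬? (3 ∣? 8)} tt

optimalBDP : ∀ {m n M N} → m ≡ M → n ≡ N → .{{_ : NonZero m}} → .{{_ : NonZero n}} → Packing m n →
  Σ (List (List Elt)) (OptimalBDP M N (4 ∷ 5 ∷ []))
optimalBDP refl refl P = Blocks.blocks P , Blocks.optimal P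

assemble : ∀ u v → u % 2 ≡ 1 → v % 2 ≡ 1 → 1 < u → 1 < v → ThreePart u → ThreePart v →
  Σ (List (List Elt)) (OptimalBDP (4 * u) (8 * v) (4 ∷ 5 ∷ []))
assemble u v ou ov 1<u 1<v (threePart a r refl c) (threePart b r′ refl c′) = go (a ℕ.+ b ℕ.≟ 1)
  where
  instance
    4u≢0 : NonZero (4 * (3 ^ a * odd r))
    4u≢0 = ℕ.m*n≢0 4 _ {{_}} {{ℕ.>-nonZero (ℕ.<-trans z<s 1<u)}}
    8v≢0 : NonZero (8 * (3 ^ b * odd r′))
    8v≢0 = ℕ.m*n≢0 8 _ {{_}} {{ℕ.>-nonZero (ℕ.<-trans z<s 1<v)}}
  go : Dec (a ℕ.+ b ≡ 1) → Σ (List (List Elt)) (OptimalBDP (4 * (3 ^ a * odd r)) (8 * (3 ^ b * odd r′)) (4 ∷ 5 ∷ []))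
  -- The base group Z_4 × Z_8 has only 32 elements, so the empty packing fills it.
  go (no ne) = optimalBDP refl refl (Fill.packing
    (Lift.lift {{ℕ.m^n≢0 3 a}} {{ℕ.m^n≢0 3 b}} (threes a b ne) (scalarMatrix (odd r) (odd r′) c c′) (plane familyₚ r r′ c c′))
    (tablePacking 4 8 [] refl tt) refl
    (coprime-∣ (divides 2 refl) (Coprimality.sym (coprime-8 _ ou))) (coprime-8 _ ov))
  go (yes e) = exceptional a b e
    where
    exceptional : ∀ a b → a ℕ.+ b ≡ 1 → Σ (List (List Elt)) (OptimalBDP (4 * (3 ^ a * odd r)) (8 * (3 ^ b * odd r′)) (4 ∷ 5 ∷ []))
    -- The factor Z_3 joins Z_4 to form Z_12, and q = 96 / 32 = 3; in the next case it joins Z_8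
    -- instead.
    exceptional 1 0 _ = optimalBDP (lem (odd r)) (cong (8 *_) (sym (ℕ.*-identityˡ (odd r′))))
      (Fill.packing (plane family₁₂ₓ₈ r r′ c c′) (tablePacking 12 8 packing₁₂ₓ₈ refl tt) refl
        (coprime-∣ (divides 2 refl) c) (coprime-∣ (divides 3 refl) c′))
      where
      lem : ∀ w → 12 * w ≡ 4 * (3 ^ 1 * w)
      lem w = ℕ.*-assoc 4 3 w
    exceptional 0 1 _ = optimalBDP (cong (4 *_) (sym (ℕ.*-identityˡ (odd r)))) (ℕ.*-assoc 8 3 (odd r′))
      (Fill.packing (plane family₄ₓ₂₄ r r′ c c′) (tablePacking 4 24 packing₄ₓ₂₄ refl tt) refl
        (coprime-∣ (divides 6 refl) c) (coprime-∣ (divides 1 refl) c′))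
    exceptional (suc (suc _)) _ ()
    exceptional (suc zero) (suc _) ()
    exceptional zero (suc (suc _)) ()

theorem1p1 : (u v : ℕ) → 1 < u → 1 < v → u % 2 ≡ 1 → v % 2 ≡ 1 →
    Σ (List (List Elt)) (λ ℬ → OptimalBDP (4 * u) (8 * v) (4 ∷ 5 ∷ []) ℬ)
theorem1p1 u v 1<u 1<v ou ov = assemble u v ou ov 1<u 1<v (decompose u ou) (decompose v ov)
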